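{- Let $f(n)$ denote the maximum number of edges in a graph on $n$ vertices in which no two distinct cycles have the same length. Then $$\liminf_{n\to\infty}\frac{f(n)-n}{\sqrt{n}}\geq\sqrt{2+\frac{2}{5}}.$$
   Context: Graphs are finite and undirected, and loops and multiple edges are allowed. A cycle is a connected subgraph in which every vertex has degree 2 (a loop contributing 2 to the degree of its vertex); its length is its number of edges. Thus a loop is a cycle of length 1, and a pair of parallel edges forms a cycle of length 2. Two cycles are distinct if they are different as subgraphs (equivalently, have different edge sets). For a positive integer $n$, $f(n)$ is the maximum number of edges in a graph on $n$ vertices in which any two distinct cycles have different lengths. -}

module Defs where

open import Data.Fin.Base using (Fin)
open import Data.Fin.Properties using () renaming (_≟_ to _≟ᶠ_)
open import Data.Fin.Subset using (Subset; _∈_; _∩_; ∣_∣; Nonempty)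
open import Data.Integer.Base using (+_)
open import Data.Nat.Base as ℕ using (ℕ; NonZero)
open import Data.Product.Base using (Σ; Σ-syntax; ∃; ∃₂; _×_; _,_; proj₁; proj₂)
open import Data.Rational.Base
  using (ℚ; 0ℚ; 1ℚ; _<_; _≤_; _+_; _-_; _*_; -_; _⊔_; _⊓_; _/_; 1/_;
         Positive; positive; negative; nonNegative; nonPositive)
open import Data.Rational.Properties
open import Data.Rational.Solver using (module +-*-Solver)
open import Data.Sum.Base using (_⊎_; inj₁; inj₂)
open import Data.Vec.Base using (tabulate)
open import Level using (0ℓ)
open import Relation.Binary.Construct.Closure.ReflexiveTransitive using (Star)
open import Relation.Binary.Definitions using (tri<; tri≈; tri>)
open import Relation.Binary.PropositionalEquality
open import Relation.Nullary.Decidable.Core using (does; yes; no)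
open import Relation.Nullary.Negation.Core using (¬_; contradiction)
open import Relation.Unary using (Pred)

------------------------------------------------------------------------
-- Multigraphs

-- Vertices are Fin n and edges are Fin m.  The order of the two ends of
-- an edge is never used: adjacency and degree below are symmetric in them.
record Graph (n m : ℕ) : Set where
  field
    ends : Fin m → Fin n × Fin n

  end₁ end₂ : Fin m → Fin n
  end₁ e = proj₁ (ends e)
  end₂ e = proj₂ (ends e)

module _ {n m : ℕ} (G : Graph n m) where
  open Graph G

  record Subgraph : Set where
    field
      vertices : Subset n
      edges    : Subset m
      closed   : ∀ {e} → e ∈ edges → end₁ e ∈ vertices × end₂ e ∈ vertices

  open Subgraph

  infix 4 _≈_
  _≈_ : Subgraph → Subgraph → Set
  H ≈ K = vertices H ≡ vertices K × edges H ≡ edges K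

  Adjacent : Subgraph → Fin n → Fin n → Set
  Adjacent H u v =
    Σ[ e ∈ Fin m ] e ∈ edges H × (ends e ≡ (u , v) ⊎ ends e ≡ (v , u))

  Connected : Subgraph → Set
  Connected H =
    Nonempty (vertices H) ×
    (∀ {u v} → u ∈ vertices H → v ∈ vertices H → Star (Adjacent H) u v)

  -- A loop at v is counted in both summands.
  degree : Subgraph → Fin n → ℕ
  degree H v = ∣ edges H ∩ tabulate (λ e → does (end₁ e ≟ᶠ v)) ∣
         ℕ.+ ∣ edges H ∩ tabulate (λ e → does (end₂ e ≟ᶠ v)) ∣

  IsCycle : Subgraph → Set
  IsCycle C = Connected C × (∀ {v} → v ∈ vertices C → degree C v ≡ 2)

  length : Subgraph → ℕ
  length C = ∣ edges C ∣

  DistinctCycleLengths : Set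
  DistinctCycleLengths =
    ∀ C D → IsCycle C → IsCycle D → ¬ (C ≈ D) → length C ≢ length D

IsMaximum : Pred ℕ 0ℓ → Pred ℕ 0ℓ
IsMaximum P k = P k × (∀ {j} → P j → j ℕ.≤ k)

-- k is the value f(n).
IsMaxEdges : ℕ → ℕ → Set
IsMaxEdges n = IsMaximum (λ m → Σ[ G ∈ Graph n m ] DistinctCycleLengths G)

------------------------------------------------------------------------
-- Dedekind reals

-- L q means q < x and U q means x < q.
record ℝ : Set₁ where
  field
    L U         : Pred ℚ 0ℓ
    L-inhabited : ∃ L
    U-inhabited : ∃ U
    L-down      : ∀ {p q} → p < q → L q → L p
    U-up        : ∀ {p q} → p < q → U p → U q
    L-open      : ∀ {p} → L p → ∃ λ q → p < q × L q
    U-open      : ∀ {q} → U q → ∃ λ p → p < q × U p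
    disjoint    : ∀ {q} → L q → ¬ U q
    located     : ∀ {p q} → p < q → L p ⊎ U q

  L<U : ∀ {p q} → L p → U q → p < q
  L<U {p} {q} Lp Uq with <-cmp p q
  ... | tri< p<q _ _  = p<q
  ... | tri≈ _ refl _ = contradiction Uq (disjoint Lp)
  ... | tri> _ _ q<p  = contradiction Uq (disjoint (L-down q<p Lp))

private
  p<p+1 : ∀ p → p < p + 1ℚ
  p<p+1 p = subst (_< p + 1ℚ) (+-identityʳ p) (+-monoʳ-< p (positive⁻¹ 1ℚ))

  p-1<p : ∀ p → p - 1ℚ < p
  p-1<p p = subst (p - 1ℚ <_) (+-identityʳ p) (+-monoʳ-< p (negative⁻¹ (- 1ℚ)))

fromℚ : ℚ → ℝ
fromℚ x = record
  { L           = _< x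
  ; U           = x <_
  ; L-inhabited = x - 1ℚ , p-1<p x
  ; U-inhabited = x + 1ℚ , p<p+1 x
  ; L-down      = <-trans
  ; U-up        = λ p<q x<p → <-trans x<p p<q
  ; L-open      = <-dense
  ; U-open      = λ x<q → let (p , x<p , p<q) = <-dense x<q in p , p<q , x<p
  ; disjoint    = <-asym
  ; located     = loc
  }
  where
  loc : ∀ {p q} → p < q → p < x ⊎ x < q
  loc {p} p<q with p <? x
  ... | yes p<x = inj₁ p<x
  ... | no  p≮x = inj₂ (≤-<-trans (≮⇒≥ p≮x) p<q)

IsPositive : ℝ → Set
IsPositive x = ℝ.L x 0ℚ

private
  *-monoˡ-< : ∀ {r p q} → 0ℚ < r → p < q → r * p < r * q
  *-monoˡ-< {r} 0<r = *-monoʳ-<-pos r {{positive 0<r}}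

  *-monoʳ-< : ∀ {r p q} → 0ℚ < r → p < q → p * r < q * r
  *-monoʳ-< {r} 0<r = *-monoˡ-<-pos r {{positive 0<r}}

  *-pos : ∀ {p q} → 0ℚ < p → 0ℚ < q → 0ℚ < p * q
  *-pos {p} {q} 0<p 0<q = subst (_< p * q) (*-zeroʳ p) (*-monoˡ-< 0<p 0<q)

  square-mono : ∀ {p q} → 0ℚ ≤ p → p < q → p * p < q * q
  square-mono {p} {q} 0≤p p<q = ≤-<-trans
    (*-monoˡ-≤-nonNeg p {{nonNegative 0≤p}} (<⇒≤ p<q))
    (*-monoʳ-< (≤-<-trans 0≤p p<q) p<q)

  p<q⇒0<q-p : ∀ {p q} → p < q → 0ℚ < q - p
  p<q⇒0<q-p {p} {q} p<q = subst (_< q - p) (+-inverseʳ p) (+-monoˡ-< (- p) p<q)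

  0<q-p⇒p<q : ∀ {p q} → 0ℚ < q - p → p < q
  0<q-p⇒p<q {p} {q} h = subst₂ _<_ (+-identityʳ p)
    (solve 2 (λ p q → p :+ (q :- p) := q) refl p q) (+-monoʳ-< p h)
    where open +-*-Solver

  module Inverse {r} (0<r : 0ℚ < r) where
    instance
      _ = positive 0<r
      _ = pos⇒nonZero r

    r⁻¹ : ℚ
    r⁻¹ = 1/ r

    0<r⁻¹ : 0ℚ < r⁻¹
    0<r⁻¹ = positive⁻¹ r⁻¹ {{1/pos⇒pos r}}

    k*r⁻¹*r : ∀ k → k * r⁻¹ * r ≡ k
    k*r⁻¹*r k = trans (*-assoc k r⁻¹ r) (trans (cong (k *_) (*-inverseˡ r)) (*-identityʳ k))

    k*r*r⁻¹ : ∀ k → k * r * r⁻¹ ≡ k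
    k*r*r⁻¹ k = trans (*-assoc k r r⁻¹) (trans (cong (k *_) (*-inverseʳ r)) (*-identityʳ k))

    *<⇒< : ∀ {q k} → q * r < k → q < k * r⁻¹
    *<⇒< {q} h = subst (_< _) (k*r*r⁻¹ q) (*-monoʳ-< 0<r⁻¹ h)

    <⇒*< : ∀ {q k} → q < k * r⁻¹ → q * r < k
    <⇒*< {k = k} h = subst (_ <_) (k*r⁻¹*r k) (*-monoʳ-< 0<r h)

    <*⇒< : ∀ {q k} → k < q * r → k * r⁻¹ < q
    <*⇒< {q} h = subst (_ <_) (k*r*r⁻¹ q) (*-monoʳ-< 0<r⁻¹ h)

    <⇒<* : ∀ {q k} → k * r⁻¹ < q → k < q * r
    <⇒<* {k = k} h = subst (_< _) (k*r⁻¹*r k) (*-monoʳ-< 0<r h)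

-- The square root of a real x ≥ 0 (for x < 0 it is 0).
√ : ℝ → ℝ
√ x = record
  { L           = λ q → q < 0ℚ ⊎ X.L (q * q)
  ; U           = λ q → 0ℚ < q × X.U (q * q)
  ; L-inhabited = - 1ℚ , inj₁ (negative⁻¹ (- 1ℚ))
  ; U-inhabited = U-inh X.U-inhabited
  ; L-down      = down
  ; U-up        = λ p<q (0<p , Up) →
                    <-trans 0<p p<q , X.U-up (square-mono (<⇒≤ 0<p) p<q) Up
  ; L-open      = L-opn
  ; U-open      = U-opn
  ; disjoint    = λ { (inj₁ q<0) (0<q , _) → <-asym q<0 0<q
                    ; (inj₂ Lq)  (_ , Uq)  → X.disjoint Lq Uq }
  ; located     = loc
  }
  where
  module X = ℝ x

  U-inh : ∃ X.U → ∃ λ q → 0ℚ < q × X.U (q * q)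
  U-inh (u , Uu) = q , 0<q , X.U-up (<-≤-trans u<q q≤q²) Uu
    where
    q    = 1ℚ ⊔ (u + 1ℚ)
    1≤q  = p≤p⊔q 1ℚ (u + 1ℚ)
    0<q  = <-≤-trans (positive⁻¹ 1ℚ) 1≤q
    u<q  = <-≤-trans (p<p+1 u) (p≤q⊔p 1ℚ (u + 1ℚ))
    q≤q² : q ≤ q * q
    q≤q² = subst (_≤ q * q) (*-identityʳ q)
             (*-monoˡ-≤-nonNeg q {{nonNegative (<⇒≤ 0<q)}} 1≤q)

  down : ∀ {p q} → p < q → q < 0ℚ ⊎ X.L (q * q) → p < 0ℚ ⊎ X.L (p * p)
  down p<q (inj₁ q<0) = inj₁ (<-trans p<q q<0)
  down {p} p<q (inj₂ Lq) with p <? 0ℚ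
  ... | yes p<0 = inj₁ p<0
  ... | no  p≮0 = inj₂ (X.L-down (square-mono (≮⇒≥ p≮0) p<q) Lq)

  loc : ∀ {p q} → p < q → (p < 0ℚ ⊎ X.L (p * p)) ⊎ (0ℚ < q × X.U (q * q))
  loc {p} p<q with p <? 0ℚ
  ... | yes p<0 = inj₁ (inj₁ p<0)
  ... | no  p≮0 with X.located (square-mono (≮⇒≥ p≮0) p<q)
  ...   | inj₁ Lp = inj₁ (inj₂ Lp)
  ...   | inj₂ Uq = inj₂ (≤-<-trans (≮⇒≥ p≮0) p<q , Uq)

  -- For p ≥ 0 and p² < s, the point q = p + (s - p²) / c with
  -- c = 2p + 1 + s satisfies p < q and q² < s.
  L-opn : ∀ {p} → p < 0ℚ ⊎ X.L (p * p) → ∃ λ q → p < q × (q < 0ℚ ⊎ X.L (q * q))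
  L-opn (inj₁ p<0) = let (q , p<q , q<0) = <-dense p<0 in q , p<q , inj₁ q<0
  L-opn {p} (inj₂ Lp) with p <? 0ℚ
  ... | yes p<0 = let (q , p<q , q<0) = <-dense p<0 in q , p<q , inj₁ q<0
  ... | no  p≮0 with X.L-open Lp
  ...   | s , p²<s , Ls = p + δ , p<q , inj₂ (X.L-down q²<s Ls)
    where
    0≤p  = ≮⇒≥ p≮0
    0≤p² : 0ℚ ≤ p * p
    0≤p² = subst (_≤ p * p) (*-zeroʳ p) (*-monoˡ-≤-nonNeg p {{nonNegative 0≤p}} 0≤p)
    0<s  = ≤-<-trans 0≤p² p²<s
    d    = s - p * p
    0<d  = p<q⇒0<q-p p²<s
    c    = p + p + 1ℚ + s
    0<c : 0ℚ < c
    0<c  = +-mono-< (+-mono-≤-< (+-mono-≤ 0≤p 0≤p) (positive⁻¹ 1ℚ)) 0<s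
    open Inverse 0<c
    δ    = d * r⁻¹
    0<δ  = *-pos 0<d 0<r⁻¹
    p<q : p < p + δ
    p<q  = subst (_< p + δ) (+-identityʳ p) (+-monoʳ-< p 0<δ)
    -- s - q² = δ (s + (1 - δ)), using d = δ c; and c (1 - δ) = c - d > 0.
    open +-*-Solver
    0<1-δ : 0ℚ < 1ℚ - δ
    0<1-δ = p<q⇒0<q-p {δ} {1ℚ} (<*⇒< (subst (d <_) (sym (*-identityˡ c))
      (0<q-p⇒p<q (subst (0ℚ <_)
        (solve 2 (λ p s → p :+ p :+ con 1ℚ :+ p :* p
                        := p :+ p :+ con 1ℚ :+ s :- (s :- p :* p)) refl p s)
        (+-mono-<-≤ (+-mono-≤-< (+-mono-≤ 0≤p 0≤p) (positive⁻¹ 1ℚ)) 0≤p²)))))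
    eq : δ * (s + (1ℚ - δ)) ≡ s - (p + δ) * (p + δ)
    eq = trans
      (solve 3 (λ p s e → e :* (s :+ (con 1ℚ :- e))
                 := e :* (p :+ p :+ con 1ℚ :+ s) :- (p :+ p) :* e :- e :* e) refl p s δ)
      (trans (cong (λ z → z - (p + p) * δ - δ * δ) (k*r⁻¹*r d))
      (solve 3 (λ p s e → s :- p :* p :- (p :+ p) :* e :- e :* e
                 := s :- (p :+ e) :* (p :+ e)) refl p s δ))
    q²<s : (p + δ) * (p + δ) < s
    q²<s = 0<q-p⇒p<q (subst (0ℚ <_) eq (*-pos 0<δ (+-mono-< 0<s 0<1-δ)))

  -- For q > 0 and t < q² with t > 0, one Newton step p = q - (q² - t) / 2q
  -- satisfies 0 < p < q and t < p².
  U-opn : ∀ {q} → 0ℚ < q × X.U (q * q) → ∃ λ p → p < q × 0ℚ < p × X.U (p * p)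
  U-opn {q} (0<q , Uq) = step (X.U-open Uq)
    where
    step : (∃ λ t → t < q * q × X.U t) → ∃ λ p → p < q × 0ℚ < p × X.U (p * p)
    step (t₀ , t₀<q² , Ut₀) with <-dense (*-pos 0<q 0<q)
    ... | t₁ , 0<t₁ , t₁<q² = q - δ , p<q , 0<p , X.U-up t<p² Ut
      where
      t    = t₀ ⊔ t₁
      0<t  = <-≤-trans 0<t₁ (p≤q⊔p t₀ t₁)
      t<q² : t < q * q
      t<q² with ⊔-sel t₀ t₁
      ... | inj₁ e = subst (_< q * q) (sym e) t₀<q²
      ... | inj₂ e = subst (_< q * q) (sym e) t₁<q²
      Ut : X.U t
      Ut with t₀ <? t
      ... | yes t₀<t = X.U-up t₀<t Ut₀
      ... | no  t₀≮t = subst X.U (≤-antisym (p≤p⊔q t₀ t₁) (≮⇒≥ t₀≮t)) Ut₀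
      c    = q + q
      0<c : 0ℚ < c
      0<c  = +-mono-< 0<q 0<q
      open Inverse 0<c
      open +-*-Solver
      d    = q * q - t
      0<d  = p<q⇒0<q-p t<q²
      δ    = d * r⁻¹
      0<δ  = *-pos 0<d 0<r⁻¹
      p<q : q - δ < q
      p<q  = subst (q - δ <_) (+-identityʳ q) (+-monoʳ-< q (neg-antimono-< 0<δ))
      0<p : 0ℚ < q - δ
      0<p  = p<q⇒0<q-p {δ} {q} (<*⇒< (0<q-p⇒p<q (subst (0ℚ <_)
        (solve 2 (λ q t → q :* q :+ t := q :* (q :+ q) :- (q :* q :- t)) refl q t)
        (+-mono-< (*-pos 0<q 0<q) 0<t))))
      eq : δ * δ ≡ (q - δ) * (q - δ) - t
      eq = trans
        (solve 3 (λ q t e → e :* e := q :* q :- t :- (q :* q :- t) :+ e :* e) refl q t δ)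
        (trans (cong (λ z → q * q - t - z + δ * δ) (sym (k*r⁻¹*r d)))
        (solve 3 (λ q t e → q :* q :- t :- e :* (q :+ q) :+ e :* e
                   := (q :- e) :* (q :- e) :- t) refl q t δ))
      t<p² : t < (q - δ) * (q - δ)
      t<p² = 0<q-p⇒p<q (subst (0ℚ <_) eq (*-pos 0<δ 0<δ))

-- The quotient k / y.  For y > 0, q < k / y means q y < k; since q y lies
-- between q r and q s whenever r < y < s, this holds exactly when both
-- q r < k and q s < k for some such r and s (r may be taken positive).
_÷_⟨_⟩ : ℚ → (y : ℝ) → IsPositive y → ℝ
k ÷ y ⟨ 0<y ⟩ = record
  { L           = L′
  ; U           = U′
  ; L-inhabited = (k ⊓ 0ℚ - 1ℚ) * r₀⁻¹ , L-inh
  ; U-inhabited = (k ⊔ 0ℚ + 1ℚ) * r₀⁻¹ , U-inh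
  ; L-down      = λ p<q (r , s , 0<r , Lr , Us , a , b) →
                    r , s , 0<r , Lr , Us ,
                    <-trans (*-monoʳ-< 0<r p<q) a ,
                    <-trans (*-monoʳ-< (<-trans 0<r (Y.L<U Lr Us)) p<q) b
  ; U-up        = λ p<q (r , s , 0<r , Lr , Us , a , b) →
                    r , s , 0<r , Lr , Us ,
                    <-trans a (*-monoʳ-< 0<r p<q) ,
                    <-trans b (*-monoʳ-< (<-trans 0<r (Y.L<U Lr Us)) p<q)
  ; L-open      = L-opn
  ; U-open      = U-opn
  ; disjoint    = λ {q} → disj {q}
  ; located     = loc
  }
  where
  module Y = ℝ y

  L′ U′ : Pred ℚ 0ℓ
  L′ q = ∃₂ λ r s → 0ℚ < r × Y.L r × Y.U s × q * r < k × q * s < k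
  U′ q = ∃₂ λ r s → 0ℚ < r × Y.L r × Y.U s × k < q * r × k < q * s

  r₀  = proj₁ (Y.L-open 0<y)
  0<r₀ = proj₁ (proj₂ (Y.L-open 0<y))
  Lr₀ = proj₂ (proj₂ (Y.L-open 0<y))
  s₀  = proj₁ Y.U-inhabited
  Us₀ = proj₂ Y.U-inhabited
  r₀<s₀ = Y.L<U Lr₀ Us₀
  0<s₀ = <-trans 0<r₀ r₀<s₀
  open Inverse 0<r₀ using () renaming (r⁻¹ to r₀⁻¹; k*r⁻¹*r to k*r₀⁻¹*r₀; 0<r⁻¹ to 0<r₀⁻¹)

  antimono : ∀ {q r s} → q ≤ 0ℚ → r ≤ s → q * s ≤ q * r
  antimono {q} q≤0 = *-monoˡ-≤-nonPos q {{nonPositive q≤0}}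

  mono : ∀ {q r s} → 0ℚ ≤ q → r ≤ s → q * r ≤ q * s
  mono {q} 0≤q = *-monoˡ-≤-nonNeg q {{nonNegative 0≤q}}

  L-inh : L′ ((k ⊓ 0ℚ - 1ℚ) * r₀⁻¹)
  L-inh = r₀ , s₀ , 0<r₀ , Lr₀ , Us₀ , qr<k , ≤-<-trans (antimono q≤0 (<⇒≤ r₀<s₀)) qr<k
    where
    a = k ⊓ 0ℚ - 1ℚ
    a<0 : a < 0ℚ
    a<0 = <-≤-trans (p-1<p (k ⊓ 0ℚ)) (p⊓q≤q k 0ℚ)
    q≤0 : a * r₀⁻¹ ≤ 0ℚ
    q≤0 = subst (a * r₀⁻¹ ≤_) (*-zeroˡ r₀⁻¹) (<⇒≤ (*-monoʳ-< 0<r₀⁻¹ a<0))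
    qr<k : a * r₀⁻¹ * r₀ < k
    qr<k = subst (_< k) (sym (k*r₀⁻¹*r₀ a)) (<-≤-trans (p-1<p (k ⊓ 0ℚ)) (p⊓q≤p k 0ℚ))

  U-inh : U′ ((k ⊔ 0ℚ + 1ℚ) * r₀⁻¹)
  U-inh = r₀ , s₀ , 0<r₀ , Lr₀ , Us₀ , k<qr , <-≤-trans k<qr (mono 0≤q (<⇒≤ r₀<s₀))
    where
    a = k ⊔ 0ℚ + 1ℚ
    0<a : 0ℚ < a
    0<a = ≤-<-trans (p≤q⊔p k 0ℚ) (p<p+1 (k ⊔ 0ℚ))
    0≤q : 0ℚ ≤ a * r₀⁻¹
    0≤q = <⇒≤ (*-pos 0<a 0<r₀⁻¹)
    k<qr : k < a * r₀⁻¹ * r₀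
    k<qr = subst (k <_) (sym (k*r₀⁻¹*r₀ a)) (≤-<-trans (p≤p⊔q k 0ℚ) (p<p+1 (k ⊔ 0ℚ)))

  L-opn : ∀ {p} → L′ p → ∃ λ q → p < q × L′ q
  L-opn {p} (r , s , 0<r , Lr , Us , a , b) = between (<-dense (p<m (⊓-sel kr ks)))
    where
    0<s = <-trans 0<r (Y.L<U Lr Us)
    module R = Inverse 0<r
    module S = Inverse 0<s
    kr = k * R.r⁻¹
    ks = k * S.r⁻¹
    p<m : kr ⊓ ks ≡ kr ⊎ kr ⊓ ks ≡ ks → p < kr ⊓ ks
    p<m (inj₁ e) = subst (p <_) (sym e) (R.*<⇒< a)
    p<m (inj₂ e) = subst (p <_) (sym e) (S.*<⇒< b)
    between : (∃ λ q → p < q × q < kr ⊓ ks) → ∃ λ q → p < q × L′ q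
    between (q , p<q , q<m) = q , p<q , r , s , 0<r , Lr , Us ,
      R.<⇒*< (<-≤-trans q<m (p⊓q≤p kr ks)) , S.<⇒*< (<-≤-trans q<m (p⊓q≤q kr ks))

  U-opn : ∀ {q} → U′ q → ∃ λ p → p < q × U′ p
  U-opn {q} (r , s , 0<r , Lr , Us , a , b) = between (<-dense (m<q (⊔-sel kr ks)))
    where
    0<s = <-trans 0<r (Y.L<U Lr Us)
    module R = Inverse 0<r
    module S = Inverse 0<s
    kr = k * R.r⁻¹
    ks = k * S.r⁻¹
    m<q : kr ⊔ ks ≡ kr ⊎ kr ⊔ ks ≡ ks → kr ⊔ ks < q
    m<q (inj₁ e) = subst (_< q) (sym e) (R.<*⇒< a)
    m<q (inj₂ e) = subst (_< q) (sym e) (S.<*⇒< b)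
    between : (∃ λ p → kr ⊔ ks < p × p < q) → ∃ λ p → p < q × U′ p
    between (p , m<p , p<q) = p , p<q , r , s , 0<r , Lr , Us ,
      R.<⇒<* (≤-<-trans (p≤p⊔q kr ks) m<p) , S.<⇒<* (≤-<-trans (p≤q⊔p kr ks) m<p)

  disj : ∀ {q} → L′ q → ¬ U′ q
  disj {q} (r₁ , s₁ , _ , Lr₁ , Us₁ , a₁ , b₁) (r₂ , s₂ , _ , Lr₂ , Us₂ , a₂ , b₂)
    with q <? 0ℚ
  ... | yes q<0 = <-irrefl refl
        (<-trans b₂ (≤-<-trans (antimono (<⇒≤ q<0) (<⇒≤ (Y.L<U Lr₁ Us₂))) a₁))
  ... | no  q≮0 = <-irrefl refl
        (<-trans a₂ (≤-<-trans (mono (≮⇒≥ q≮0) (<⇒≤ (Y.L<U Lr₂ Us₁))) b₁))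

  nonPos*pos : ∀ {q r} → q ≤ 0ℚ → 0ℚ < r → q * r ≤ 0ℚ
  nonPos*pos {q} q≤0 0<r = subst (q * _ ≤_) (*-zeroʳ q) (antimono q≤0 (<⇒≤ 0<r))

  nonNeg*pos : ∀ {q r} → 0ℚ ≤ q → 0ℚ < r → 0ℚ ≤ q * r
  nonNeg*pos {q} 0≤q 0<r = subst (_≤ q * _) (*-zeroʳ q) (mono 0≤q (<⇒≤ 0<r))

  loc : ∀ {p q} → p < q → L′ p ⊎ U′ q
  loc {p} {q} p<q with <-cmp k 0ℚ
  loc {p} {q} p<q | tri≈ _ refl _ with p <? 0ℚ
  ... | yes p<0 = inj₁ (r₀ , s₀ , 0<r₀ , Lr₀ , Us₀ , neg 0<r₀ , neg 0<s₀)
    where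
    neg : ∀ {r} → 0ℚ < r → p * r < 0ℚ
    neg {r} 0<r = subst (p * r <_) (*-zeroˡ r) (*-monoʳ-< 0<r p<0)
  ... | no  p≮0 = inj₂ (r₀ , s₀ , 0<r₀ , Lr₀ , Us₀ , *-pos 0<q 0<r₀ , *-pos 0<q 0<s₀)
    where 0<q = ≤-<-trans (≮⇒≥ p≮0) p<q
  loc {p} {q} p<q | tri> _ _ 0<k with 0ℚ <? p
  ... | no  0≮p = inj₁ (r₀ , s₀ , 0<r₀ , Lr₀ , Us₀ ,
        ≤-<-trans (nonPos*pos (≮⇒≥ 0≮p) 0<r₀) 0<k ,
        ≤-<-trans (nonPos*pos (≮⇒≥ 0≮p) 0<s₀) 0<k)
  ... | yes 0<p = split (Y.located kq<kp)
    where
    0<q = <-trans 0<p p<q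
    module P = Inverse 0<p
    module Q = Inverse 0<q
    kq<kp : k * Q.r⁻¹ < k * P.r⁻¹
    kq<kp = P.*<⇒< (subst (_< k) (*-comm p (k * Q.r⁻¹))
      (subst (p * (k * Q.r⁻¹) <_) (trans (*-comm q (k * Q.r⁻¹)) (Q.k*r⁻¹*r k))
        (*-monoʳ-< (*-pos 0<k Q.0<r⁻¹) p<q)))
    split : Y.L (k * Q.r⁻¹) ⊎ Y.U (k * P.r⁻¹) → L′ p ⊎ U′ q
    split (inj₁ Lkq) = let (r , kq<r , Lr) = Y.L-open Lkq
                           k<qr = subst (k <_) (*-comm r q) (Q.<⇒<* kq<r) in
      inj₂ (r , s₀ , <-trans (*-pos 0<k Q.0<r⁻¹) kq<r , Lr , Us₀ , k<qr ,
            <-trans k<qr (*-monoˡ-< 0<q (Y.L<U Lr Us₀)))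
    split (inj₂ Ukp) = let (s , s<kp , Us) = Y.U-open Ukp
                           ps<k = subst (_< k) (*-comm s p) (P.<⇒*< s<kp) in
      inj₁ (r₀ , s , 0<r₀ , Lr₀ , Us ,
            <-trans (*-monoˡ-< 0<p (Y.L<U Lr₀ Us)) ps<k , ps<k)
  loc {p} {q} p<q | tri< k<0 _ _ with q <? 0ℚ
  ... | no  q≮0 = inj₂ (r₀ , s₀ , 0<r₀ , Lr₀ , Us₀ ,
        <-≤-trans k<0 (nonNeg*pos (≮⇒≥ q≮0) 0<r₀) ,
        <-≤-trans k<0 (nonNeg*pos (≮⇒≥ q≮0) 0<s₀))
  ... | yes q<0 = split (Y.located kp<kq)
    where
    p<0 = <-trans p<q q<0
    0<-p = neg-antimono-< p<0
    0<-q = neg-antimono-< q<0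
    0<-k = neg-antimono-< k<0
    module P = Inverse 0<-p
    module Q = Inverse 0<-q
    kp<kq : - k * P.r⁻¹ < - k * Q.r⁻¹
    kp<kq = Q.*<⇒< (subst (_< - k) (*-comm (- q) (- k * P.r⁻¹))
      (subst (- q * (- k * P.r⁻¹) <_) (trans (*-comm (- p) (- k * P.r⁻¹)) (P.k*r⁻¹*r (- k)))
        (*-monoʳ-< (*-pos 0<-k P.0<r⁻¹) (neg-antimono-< p<q))))
    flip : ∀ a b → - (a * - b) ≡ b * a
    flip = solve 2 (λ a b → :- (a :* (:- b)) := b :* a) refl
      where open +-*-Solver
    negneg : ∀ a → - (- a) ≡ a
    negneg = solve 1 (λ a → :- (:- a) := a) refl
      where open +-*-Solver
    split : Y.L (- k * P.r⁻¹) ⊎ Y.U (- k * Q.r⁻¹) → L′ p ⊎ U′ q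
    split (inj₁ Lkp) = let (r , kp<r , Lr) = Y.L-open Lkp
                           pr<k = subst₂ _<_ (flip r p) (negneg k)
                                    (neg-antimono-< (P.<⇒<* kp<r)) in
      inj₁ (r , s₀ , <-trans (*-pos 0<-k P.0<r⁻¹) kp<r , Lr , Us₀ , pr<k ,
            ≤-<-trans (antimono (<⇒≤ p<0) (<⇒≤ (Y.L<U Lr Us₀))) pr<k)
    split (inj₂ Ukq) = let (s , s<kq , Us) = Y.U-open Ukq
                           k<qs = subst₂ _<_ (negneg k) (flip s q)
                                    (neg-antimono-< (Q.<⇒*< s<kq)) in
      inj₂ (r₀ , s , 0<r₀ , Lr₀ , Us ,
            <-≤-trans k<qs (antimono (<⇒≤ q<0) (<⇒≤ (Y.L<U Lr₀ Us))) , k<qs)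

fromℕ : ℕ → ℝ
fromℕ n = fromℚ (+ n / 1)

√-positive : ∀ n → .{{_ : NonZero n}} → IsPositive (√ (fromℕ n))
√-positive n@(ℕ.suc _) = inj₂ (positive⁻¹ (+ n / 1) {{normalize-pos n 1}})

------------------------------------------------------------------------
-- Limit inferior

-- Lower Dedekind cuts; the empty cut is -∞ and the full cut is +∞.  A
-- liminf lives here because constructively it need not have an upper cut;
-- classically these are exactly the extended reals.
record LowerReal : Set₁ where
  field
    L      : Pred ℚ 0ℓ
    L-down : ∀ {p q} → p < q → L q → L p
    L-open : ∀ {p} → L p → ∃ λ q → p < q × L q

open LowerReal

lower : ℝ → LowerReal
lower x = record { L = ℝ.L x ; L-down = ℝ.L-down x ; L-open = ℝ.L-open x }

infix 4 _≤ᴸ_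
_≤ᴸ_ : LowerReal → LowerReal → Set
x ≤ᴸ y = ∀ {q} → L x q → L y q

sup : {I : Set} → (I → LowerReal) → LowerReal
sup x = record
  { L      = λ q → ∃ λ i → L (x i) q
  ; L-down = λ p<q (i , Lq) → i , L-down (x i) p<q Lq
  ; L-open = λ (i , Lp) → let (q , p<q , Lq) = L-open (x i) Lp in q , p<q , i , Lq
  }

-- An intersection of open cuts need not be open, so q < inf x requires
-- some q′ > q below every x i.
inf : {I : Set} → (I → LowerReal) → LowerReal
inf x = record
  { L      = λ q → ∃ λ q′ → q < q′ × (∀ i → L (x i) q′)
  ; L-down = λ p<q (q′ , q<q′ , h) → q′ , <-trans p<q q<q′ , h
  ; L-open = λ (q′ , p<q′ , h) →
               let (q , p<q , q<q′) = <-dense p<q′ in q , p<q , q′ , q<q′ , h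
  }

-- For sequences indexed by the positive integers.
liminf : ((n : ℕ) → .{{NonZero n}} → ℝ) → LowerReal
liminf a = sup λ N → inf {Σ[ n ∈ ℕ ] NonZero n × N ℕ.≤ n} λ (n , n≢0 , _) →
  lower (a n {{n≢0}})

{-# OPTIONS --safe #-}

-- A ring is a chain of j digons and one path, closed up at a hub.  If the
-- two branches of the i-th digon differ in length by 2^(i-1), then the cycles
-- through the hub have 2^j consecutive lengths; the other cycles are the
-- digons.  Such a ring has cyclomatic number j + 1, and gluing rings at a
-- common hub creates no new cycles.  The graphs consist of T rounds; each of
-- them adds 31 plain cycles and 4, 2 and 1 rings with 2, 3 and 5 digons, of
-- total cyclomatic number 57, and uses 114 cycle lengths.  Over all rounds
-- the lengths are exactly 1, …, 114 T, and the number of vertices is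
-- (2699/2) T² + O(T), where 57² / (2699/2) = 2.4075… > 12/5.

module Submission where

open import Defs
open import Data.Nat.Base using (ℕ; NonZero)

-- A ring weighs its shortest cycle through the hub plus the longer branches of its digons, so a
-- digon costs only about half its length. The obstacle is that the path of the ring must keep a
-- positive length, so the digons have to be short compared with the ring. Hence a round does not
-- take a block of consecutive lengths: 1, ..., 114 T is cut in fixed proportions into six regions,
-- and every round takes its share of each. All lengths of a round are then affine in its index and
-- in the number of rounds to follow, and one computation with coefficients checks every round at
-- once. Cycles are classified without following walks: it suffices to list 2-regular edge sets such
-- that every nonempty edge set with degrees 0 or 2 contains a listed one. Lengths enter as edge
-- weights, so that only small graphs are glued by hand; subdivision turns weights into numbers of
-- edges at the end.

module Cycles where
  open import Data.Bool.Base using (Bool; true; false)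
  open import Data.Empty using (⊥-elim)
  open import Data.Fin.Base using (Fin; zero; suc)
  open import Data.Fin.Properties using (suc-injective; any?) renaming (_≟_ to _≟ᶠ_)
  open import Data.Fin.Subset using (Subset; _∈_; _⊆_; _∩_; ∣_∣; Nonempty; ⊥; ⊤)
  open import Data.Fin.Subset.Properties
    using (⊥⊆; s⊆s; out⊆; drop-∷-⊆; ⊆-antisym; ∣⊤∣≡n; _∈?_)
  open import Data.List.Base as List using (List; []; _∷_; _++_; map)
  open import Data.List.Membership.Propositional using (find) renaming (_∈_ to _∈ˡ_)
  open import Data.List.Membership.Propositional.Properties using (∈-map⁺)
  open import Data.List.Properties using (map-++; map-∘; map-cong; ++-assoc)
  open import Data.List.Relation.Unary.All as All using (All; []; _∷_)
  import Data.List.Relation.Unary.All.Properties as All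
  open import Data.List.Relation.Unary.Any as Any using (Any; here; there)
  import Data.List.Relation.Unary.Any.Properties as Any
  open import Data.List.Relation.Unary.Unique.Propositional using (Unique; []; _∷_)
  open import Data.Nat.Base using (zero; suc; pred; _+_; _≤_; _<_; z≤n; s≤s)
  open import Data.Nat.Properties hiding (suc-injective; 0≢1+n)
  open import Data.Product.Base as Product using (Σ; ∃; _×_; _,_; proj₁; proj₂)
  open import Data.Sum.Base using (_⊎_; inj₁; inj₂)
  open import Data.Vec.Base using ([]; _∷_; lookup; tabulate; here; there)
  open import Data.Vec.Functional using () renaming (_∷_ to _◂_)
  open import Data.Vec.Properties using ([]=⇒lookup; lookup⇒[]=; lookup-replicate)
  open import Function.Base using (_∘_; case_of_)
  open import Relation.Binary.Construct.Closure.ReflexiveTransitive using (Star; ε; _◅_)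
  open import Relation.Binary.PropositionalEquality
  open import Relation.Nullary.Decidable.Core using (does; yes; no)
  open import Relation.Nullary.Negation.Core using (¬_; contradiction)

  -- Sums over subsets

  infixr 7 _⊙_
  _⊙_ : Bool → ℕ → ℕ
  false ⊙ k = 0
  true  ⊙ k = k

  total : ∀ {m} → Subset m → (Fin m → ℕ) → ℕ
  total []      f = 0
  total (b ∷ F) f = b ⊙ f zero + total F (f ∘ suc)

  total-zero : ∀ {m} (F : Subset m) {f} → (∀ i → f i ≡ 0) → total F f ≡ 0
  total-zero []          f≡0 = refl
  total-zero (false ∷ F) f≡0 = total-zero F (f≡0 ∘ suc)
  total-zero (true  ∷ F) f≡0 = cong₂ _+_ (f≡0 zero) (total-zero F (f≡0 ∘ suc))

  total-⊥ : ∀ m (f : Fin m → ℕ) → total ⊥ f ≡ 0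
  total-⊥ zero    f = refl
  total-⊥ (suc m) f = total-⊥ m (f ∘ suc)

  total-cong : ∀ {m} (F : Subset m) {f g} → (∀ {i} → i ∈ F → f i ≡ g i) → total F f ≡ total F g
  total-cong []          f≡g = refl
  total-cong (false ∷ F) f≡g = total-cong F (f≡g ∘ there)
  total-cong (true  ∷ F) f≡g = cong₂ _+_ (f≡g here) (total-cong F (f≡g ∘ there))

  total-+ : ∀ {m} (F : Subset m) f g → total F (λ i → f i + g i) ≡ total F f + total F g
  total-+ []          f g = refl
  total-+ (false ∷ F) f g = total-+ F (f ∘ suc) (g ∘ suc)
  total-+ (true  ∷ F) f g = begin
    f zero + g zero + total F _                                ≡⟨ cong (f zero + g zero +_) (total-+ F (f ∘ suc) (g ∘ suc)) ⟩
    f zero + g zero + (total F (f ∘ suc) + total F (g ∘ suc))  ≡⟨ interchange (f zero) (g zero) _ _ ⟩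
    total (true ∷ F) f + total (true ∷ F) g                    ∎
    where
    open ≡-Reasoning
    open import Algebra.Properties.CommutativeSemigroup +-commutativeSemigroup using (interchange)

  total-mono : ∀ {m} {K F : Subset m} f → K ⊆ F → total K f ≤ total F f
  total-mono {K = []}        {[]}        f K⊆F = z≤n
  total-mono {K = false ∷ K} {false ∷ F} f K⊆F = total-mono (f ∘ suc) (drop-∷-⊆ K⊆F)
  total-mono {K = false ∷ K} {true  ∷ F} f K⊆F = m≤n⇒m≤o+n (f zero) (total-mono (f ∘ suc) (drop-∷-⊆ K⊆F))
  total-mono {K = true  ∷ K} {false ∷ F} f K⊆F = case K⊆F here of λ ()
  total-mono {K = true  ∷ K} {true  ∷ F} f K⊆F = +-monoʳ-≤ (f zero) (total-mono (f ∘ suc) (drop-∷-⊆ K⊆F))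

  ∈⇒≤total : ∀ {m} {F : Subset m} f {e} → e ∈ F → f e ≤ total F f
  ∈⇒≤total f here            = m≤m+n _ _
  ∈⇒≤total {F = b ∷ F} f (there e∈F) = m≤n⇒m≤o+n (b ⊙ f zero) (∈⇒≤total (f ∘ suc) e∈F)

  total-saturated : ∀ {m} {K F : Subset m} f → K ⊆ F → total F f ≤ total K f →
                    ∀ {e} → e ∈ F → 0 < f e → e ∈ K
  total-saturated {K = true ∷ K} f K⊆F le here _ = here
  total-saturated {K = false ∷ K} {true ∷ F} f K⊆F le here 0<f =
    contradiction (≤-<-trans (total-mono (f ∘ suc) (drop-∷-⊆ K⊆F)) (m<n+m _ 0<f)) (≤⇒≯ le)
  total-saturated {K = false ∷ K} {false ∷ F} f K⊆F le (there e∈F) 0<f =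
    there (total-saturated (f ∘ suc) (drop-∷-⊆ K⊆F) le e∈F 0<f)
  total-saturated {K = false ∷ K} {true ∷ F} f K⊆F le (there e∈F) 0<f =
    there (total-saturated (f ∘ suc) (drop-∷-⊆ K⊆F) (m+n≤o⇒n≤o (f zero) le) e∈F 0<f)
  total-saturated {K = true ∷ K} {false ∷ F} f K⊆F le (there e∈F) 0<f = case K⊆F here of λ ()
  total-saturated {K = true ∷ K} {true ∷ F} f K⊆F le (there e∈F) 0<f =
    there (total-saturated (f ∘ suc) (drop-∷-⊆ K⊆F) (+-cancelˡ-≤ (f zero) _ _ le) e∈F 0<f)

  positive-total : ∀ {m} (F : Subset m) f → 0 < total F f → Nonempty F
  positive-total (true  ∷ F) f _   = zero , here
  positive-total (false ∷ F) f 0<F = let (e , e∈F) = positive-total F (f ∘ suc) 0<F in suc e , there e∈F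

  -- Each side receives the term at `e` of the other function, which compares the two sums without
  -- subtraction.
  total-update : ∀ {m} (F : Subset m) f g e → (∀ i → i ≢ e → f i ≡ g i) →
                 total F f + lookup F e ⊙ g e ≡ total F g + lookup F e ⊙ f e
  total-update (b ∷ F) f g zero f≡g = begin
    b ⊙ f zero + total F (f ∘ suc) + b ⊙ g zero  ≡⟨ cong (λ z → b ⊙ f zero + z + b ⊙ g zero) (total-cong F λ {i} _ → f≡g (suc i) λ ()) ⟩
    b ⊙ f zero + total F (g ∘ suc) + b ⊙ g zero  ≡⟨ +-comm _ (b ⊙ g zero) ⟩
    b ⊙ g zero + (b ⊙ f zero + total F (g ∘ suc))  ≡⟨ cong (b ⊙ g zero +_) (+-comm (b ⊙ f zero) _) ⟩
    b ⊙ g zero + (total F (g ∘ suc) + b ⊙ f zero)  ≡⟨ +-assoc (b ⊙ g zero) _ _ ⟨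
    b ⊙ g zero + total F (g ∘ suc) + b ⊙ f zero  ∎
    where open ≡-Reasoning
  total-update (b ∷ F) f g (suc e) f≡g = begin
    b ⊙ f zero + total F (f ∘ suc) + lookup F e ⊙ g (suc e)    ≡⟨ +-assoc (b ⊙ f zero) _ _ ⟩
    b ⊙ f zero + (total F (f ∘ suc) + lookup F e ⊙ g (suc e))
      ≡⟨ cong₂ (λ x y → b ⊙ x + y) (f≡g zero λ ())
           (total-update F (f ∘ suc) (g ∘ suc) e λ i i≢e → f≡g (suc i) (i≢e ∘ suc-injective)) ⟩
    b ⊙ g zero + (total F (g ∘ suc) + lookup F e ⊙ f (suc e))  ≡⟨ +-assoc (b ⊙ g zero) _ _ ⟨
    b ⊙ g zero + total F (g ∘ suc) + lookup F e ⊙ f (suc e)    ∎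
    where open ≡-Reasoning

  ∣∣≡total : ∀ {m} (F : Subset m) → ∣ F ∣ ≡ total F (λ _ → 1)
  ∣∣≡total []          = refl
  ∣∣≡total (false ∷ F) = ∣∣≡total F
  ∣∣≡total (true  ∷ F) = cong suc (∣∣≡total F)

  ∣∩tabulate∣≡total : ∀ {m} (F : Subset m) (P : Fin m → Bool) → ∣ F ∩ tabulate P ∣ ≡ total F (λ i → P i ⊙ 1)
  ∣∩tabulate∣≡total []          P = refl
  ∣∩tabulate∣≡total (false ∷ F) P = ∣∩tabulate∣≡total F (P ∘ suc)
  ∣∩tabulate∣≡total (true  ∷ F) P with P zero
  ... | false = ∣∩tabulate∣≡total F (P ∘ suc)
  ... | true  = cong suc (∣∩tabulate∣≡total F (P ∘ suc))

  -- Degrees of edge sets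

  open Graph

  incidence : ∀ {n} → Fin n × Fin n → Fin n → ℕ
  incidence uw v = does (proj₁ uw ≟ᶠ v) ⊙ 1 + does (proj₂ uw ≟ᶠ v) ⊙ 1

  deg : ∀ {n m} → Graph n m → Subset m → Fin n → ℕ
  deg G F v = total F (λ e → incidence (ends G e) v)

  degree≡deg : ∀ {n m} (G : Graph n m) H v → degree G H v ≡ deg G (Subgraph.edges H) v
  degree≡deg G H v = trans
    (cong₂ _+_ (∣∩tabulate∣≡total F _) (∣∩tabulate∣≡total F _))
    (sym (total-+ F _ _))
    where F = Subgraph.edges H

  incidence₁ : ∀ {n} (uw : Fin n × Fin n) → 0 < incidence uw (proj₁ uw)
  incidence₁ (u , w) with u ≟ᶠ u
  ... | yes _  = s≤s z≤n
  ... | no u≢u = contradiction refl u≢u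

  incidence₂ : ∀ {n} (uw : Fin n × Fin n) → 0 < incidence uw (proj₂ uw)
  incidence₂ (u , w) with w ≟ᶠ w
  ... | yes _  = m≤n⇒m≤o+n _ (s≤s z≤n)
  ... | no w≢w = contradiction refl w≢w

  incidence-zero : ∀ {n} (uw : Fin n × Fin n) {v} → proj₁ uw ≢ v → proj₂ uw ≢ v → incidence uw v ≡ 0
  incidence-zero (u , w) {v} u≢v w≢v with u ≟ᶠ v | w ≟ᶠ v
  ... | yes u≡v | _       = contradiction u≡v u≢v
  ... | no _    | yes w≡v = contradiction w≡v w≢v
  ... | no _    | no _    = refl

  -- Complete lists of 2-regular edge sets, and rings built from a loop

  ZeroOrTwo : ℕ → Set
  ZeroOrTwo k = k ≡ 0 ⊎ k ≡ 2

  positive⇒two : ∀ {k} → ZeroOrTwo k → 0 < k → k ≡ 2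
  positive⇒two (inj₁ refl) ()
  positive⇒two (inj₂ k≡2)  _ = k≡2

  TwoRegular : ∀ {n m} → Graph n m → Subset m → Set
  TwoRegular G F = ∀ v → ZeroOrTwo (deg G F v)

  -- No condition is put on F at the hub, so that completeness of a graph glued
  -- together at the hub reduces to completeness of its parts.
  record Catalogue {n m} (G : Graph n m) (hub : Fin n) (Ks : List (Subset m)) : Set where
    field
      complete : ∀ F → Nonempty F → (∀ v → v ≢ hub → ZeroOrTwo (deg G F v)) → Any (_⊆ F) Ks
      regular  : All (λ K → Nonempty K × TwoRegular G K) Ks

  -- The catalogue of a graph whose edge zero is singled out: T lists the
  -- members containing edge zero (with this edge removed), R the others.
  record Opened {n m} (G : Graph n (suc m)) (hub : Fin n) (T R : List (Subset m)) : Set where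
    field
      complete : ∀ a F → Nonempty (a ∷ F) → (∀ v → v ≢ hub → ZeroOrTwo (deg G (a ∷ F) v)) →
                 (a ≡ true × Any (_⊆ F) T) ⊎ Any (_⊆ F) R
      regularT : All (λ K → TwoRegular G (true ∷ K)) T
      regularR : All (λ K → Nonempty K × TwoRegular G (false ∷ K)) R

  close : ∀ {n m} {G : Graph n (suc m)} {hub T R} → Opened G hub T R →
          Catalogue G hub (map (true ∷_) T ++ map (false ∷_) R)
  close {T = T} O = record
    { complete = λ { (a ∷ F) ne reg → case O.complete a F ne reg of λ
        { (inj₁ (refl , K⊆F)) → Any.++⁺ˡ (Any.map⁺ (Any.map s⊆s K⊆F))
        ; (inj₂ K⊆F)          → Any.++⁺ʳ (map (true ∷_) T) (Any.map⁺ (Any.map out⊆ K⊆F)) } }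
    ; regular  = All.++⁺ (All.map⁺ (All.map (λ reg → (zero , here) , reg) O.regularT))
                         (All.map⁺ (All.map (λ ((e , e∈K) , reg) → (suc e , there e∈K) , reg) O.regularR))
    }
    where module O = Opened O

  -- The ring without digons. The loop is edge zero, which `insertDigon` then refines repeatedly.
  addLoop : ∀ {n m} → Graph n m → Fin n → Graph n (suc m)
  addLoop G hub = record { ends = (hub , hub) ◂ ends G }

  addLoop-opened : ∀ {n m} {G : Graph n m} {hub Ks} → Catalogue G hub Ks → Opened (addLoop G hub) hub (⊥ ∷ []) Ks
  addLoop-opened {m = m} {G} {hub} C = record
    { complete = λ
        { true  F ne reg → inj₁ (refl , here ⊥⊆)
        ; false F (suc e , there e∈F) reg → inj₂ (C.complete F (e , e∈F) reg) }
    ; regularT = loop-regular ∷ []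
    ; regularR = C.regular
    }
    where
    module C = Catalogue C
    loop-regular : TwoRegular (addLoop G hub) (true ∷ ⊥)
    loop-regular v rewrite total-⊥ m (λ e → incidence (ends G e) v) with does (hub ≟ᶠ v)
    ... | false = inj₁ refl
    ... | true  = inj₂ refl

  -- Edge zero = (u , w) is replaced by a path of length two u – z – w through
  -- a new vertex z, whose part u – z is doubled.
  insertDigon : ∀ {n m} → Graph n (suc m) → Graph (suc n) (suc (suc (suc m)))
  insertDigon G = record
    { ends = (zero , suc (end₂ G zero)) ◂ (suc (end₁ G zero) , zero) ◂ (suc (end₁ G zero) , zero) ◂
             λ e → Product.map suc suc (ends G (suc e)) }

  module _ {n m} {G : Graph n (suc m)} {hub T R} (O : Opened G hub T R) where
    private
      module O = Opened O
      G′ = insertDigon G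

      T′ R′ : List (Subset (suc (suc m)))
      T′ = map (λ K → true ∷ false ∷ K) T ++ map (λ K → false ∷ true ∷ K) T
      R′ = (true ∷ true ∷ ⊥) ∷ map (λ K → false ∷ false ∷ K) R

      rest : ∀ (F : Subset m) → total F (λ e → incidence (Product.map suc suc (ends G (suc e))) zero) ≡ 0
      rest F = total-zero F λ _ → refl

      swap : ∀ x y z → x + ((y + 0) + z) ≡ (y + x) + z
      swap x y z = trans (cong (λ y → x + (y + z)) (+-identityʳ y))
        (trans (sym (+-assoc x y z)) (cong (_+ z) (+-comm x y)))

      -- At the old vertices, a path through the new vertex along one branch looks like the former
      -- edge zero.
      deg-left : ∀ F v → deg G′ (true ∷ true ∷ false ∷ F) (suc v) ≡ deg G (true ∷ F) v
      deg-left F v = swap (does (end₂ G zero ≟ᶠ v) ⊙ 1) (does (end₁ G zero ≟ᶠ v) ⊙ 1) _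

      deg-right : ∀ F v → deg G′ (true ∷ false ∷ true ∷ F) (suc v) ≡ deg G (true ∷ F) v
      deg-right F v = swap (does (end₂ G zero ≟ᶠ v) ⊙ 1) (does (end₁ G zero ≟ᶠ v) ⊙ 1) _

      reg-left : ∀ K → TwoRegular G (true ∷ K) → TwoRegular G′ (true ∷ true ∷ false ∷ K)
      reg-left K reg zero    = inj₂ (cong (2 +_) (rest K))
      reg-left K reg (suc v) = subst ZeroOrTwo (sym (deg-left K v)) (reg v)

      reg-right : ∀ K → TwoRegular G (true ∷ K) → TwoRegular G′ (true ∷ false ∷ true ∷ K)
      reg-right K reg zero    = inj₂ (cong (2 +_) (rest K))
      reg-right K reg (suc v) = subst ZeroOrTwo (sym (deg-right K v)) (reg v)

      reg-digon : TwoRegular G′ (false ∷ true ∷ true ∷ ⊥)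
      reg-digon zero    = inj₂ (cong (2 +_) (rest ⊥))
      reg-digon (suc v)
        rewrite total-⊥ m (λ e → incidence (Product.map suc suc (ends G (suc e))) (suc v))
        with does (end₁ G zero ≟ᶠ v)
      ... | false = inj₁ refl
      ... | true  = inj₂ refl

      reg-old : ∀ K → TwoRegular G (false ∷ K) → TwoRegular G′ (false ∷ false ∷ false ∷ K)
      reg-old K reg zero    = inj₁ (rest K)
      reg-old K reg (suc v) = reg v

      odd⇒⊥ : ∀ {z} → z ≡ 0 → ¬ ZeroOrTwo (suc z)
      odd⇒⊥ refl (inj₁ ())
      odd⇒⊥ refl (inj₂ ())

      OffHub : Subset (suc (suc (suc m))) → Set
      OffHub F = ∀ v → v ≢ suc hub → ZeroOrTwo (deg G′ F v)

      -- If both branches are present, the digon is contained. Otherwise the new vertex, which is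
      -- not the hub, must have degree 0 or 2: either edge zero and exactly one branch are present,
      -- or none of the three edges. Both cases reduce to the old graph; the remaining ones give
      -- degree 1.
      complete′ : ∀ a F → Nonempty (a ∷ F) → OffHub (a ∷ F) →
                  (a ≡ true × Any (_⊆ F) T′) ⊎ Any (_⊆ F) R′
      complete′ a (true ∷ true ∷ F) ne reg = inj₂ (here (s⊆s (s⊆s ⊥⊆)))
      complete′ true (true ∷ false ∷ F) ne reg
        with O.complete true F (zero , here)
               (λ v v≢h → subst ZeroOrTwo (deg-left F v) (reg (suc v) (v≢h ∘ suc-injective)))
      ... | inj₁ (_ , K⊆F) = inj₁ (refl , Any.++⁺ˡ (Any.map⁺ (Any.map (s⊆s ∘ s⊆s) K⊆F)))
      ... | inj₂ K⊆F       = inj₂ (there (Any.map⁺ (Any.map (out⊆ ∘ out⊆) K⊆F)))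
      complete′ true (false ∷ true ∷ F) ne reg
        with O.complete true F (zero , here)
               (λ v v≢h → subst ZeroOrTwo (deg-right F v) (reg (suc v) (v≢h ∘ suc-injective)))
      ... | inj₁ (_ , K⊆F) = inj₁ (refl ,
              Any.++⁺ʳ (map (λ K → true ∷ false ∷ K) T) (Any.map⁺ (Any.map (s⊆s ∘ s⊆s) K⊆F)))
      ... | inj₂ K⊆F       = inj₂ (there (Any.map⁺ (Any.map (out⊆ ∘ out⊆) K⊆F)))
      complete′ false (false ∷ false ∷ F) (_ , there (there (there e∈F))) reg
        with O.complete false F (_ , there e∈F) (λ v v≢h → reg (suc v) (v≢h ∘ suc-injective))
      ... | inj₂ K⊆F       = inj₂ (there (Any.map⁺ (Any.map (out⊆ ∘ out⊆) K⊆F)))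
      complete′ true  (false ∷ false ∷ F) ne reg = ⊥-elim (odd⇒⊥ (rest F) (reg zero λ ()))
      complete′ false (true  ∷ false ∷ F) ne reg = ⊥-elim (odd⇒⊥ (rest F) (reg zero λ ()))
      complete′ false (false ∷ true  ∷ F) ne reg = ⊥-elim (odd⇒⊥ (rest F) (reg zero λ ()))

    insertDigon-opened : Opened G′ (suc hub) T′ R′
    insertDigon-opened = record
      { complete = complete′
      ; regularT = All.++⁺ (All.map⁺ (All.map (λ {K} → reg-left K) O.regularT))
                           (All.map⁺ (All.map (λ {K} → reg-right K) O.regularT))
      ; regularR = ((zero , here) , reg-digon) ∷
                   All.map⁺ (All.map (λ {K} → λ ((e , e∈K) , reg) →
                     (suc (suc e) , there (there e∈K)) , reg-old K reg) O.regularR)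
      }

  -- The new vertex is zero.
  subdivide : ∀ {n m} → Graph n m → Fin m → Graph (suc n) (suc m)
  subdivide {n} {m} G e = record { ends = (zero , suc (end₂ G e)) ◂ ends′ }
    where
    ends′ : Fin m → Fin (suc n) × Fin (suc n)
    ends′ i with i ≟ᶠ e
    ... | yes _ = suc (end₁ G e) , zero
    ... | no  _ = Product.map suc suc (ends G i)

  module _ {n m} (G : Graph n m) (e : Fin m) where
    private
      G′ = subdivide G e

      ends-e : ends G′ (suc e) ≡ (suc (end₁ G e) , zero)
      ends-e with e ≟ᶠ e
      ... | yes _   = refl
      ... | no  e≢e = contradiction refl e≢e

      ends-other : ∀ i → i ≢ e → ends G′ (suc i) ≡ Product.map suc suc (ends G i)
      ends-other i i≢e with i ≟ᶠ e
      ... | yes i≡e = contradiction i≡e i≢e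
      ... | no  _   = refl

    lift : Subset m → Subset (suc m)
    lift F = lookup F e ∷ F

    private
      deg-new : ∀ a F → deg G′ (a ∷ F) zero ≡ a ⊙ 1 + lookup F e ⊙ 1
      deg-new a F = cong (a ⊙ 1 +_) (begin
        total F f                                 ≡⟨ +-identityʳ _ ⟨
        total F f + 0                             ≡⟨ cong (total F f +_) (⊙-zero (lookup F e)) ⟨
        total F f + lookup F e ⊙ 0                ≡⟨ total-update F f (λ _ → 0) e (λ i i≢e → cong (λ z → incidence z zero) (ends-other i i≢e)) ⟩
        total F (λ _ → 0) + lookup F e ⊙ f e      ≡⟨ cong₂ _+_ (total-zero F λ _ → refl) (cong (λ z → lookup F e ⊙ incidence z zero) ends-e) ⟩
        lookup F e ⊙ 1                            ∎)
        where
        open ≡-Reasoning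
        f = λ i → incidence (ends G′ (suc i)) zero
        ⊙-zero : ∀ b → b ⊙ 0 ≡ 0
        ⊙-zero false = refl
        ⊙-zero true  = refl

      deg-old : ∀ F v → deg G′ (lift F) (suc v) ≡ deg G F v
      deg-old F v = split (lookup F e)
        (trans (total-update F f g e (λ i i≢e → cong (λ z → incidence z (suc v)) (ends-other i i≢e)))
               (cong (λ z → total F g + lookup F e ⊙ incidence z (suc v)) ends-e))
        where
        open ≡-Reasoning
        f = λ i → incidence (ends G′ (suc i)) (suc v)
        g = λ i → incidence (ends G i) v
        x = does (end₁ G e ≟ᶠ v) ⊙ 1
        y = does (end₂ G e ≟ᶠ v) ⊙ 1
        split : ∀ b → total F f + b ⊙ (x + y) ≡ total F g + b ⊙ (x + 0) → b ⊙ y + total F f ≡ total F g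
        split false eq = trans (sym (+-identityʳ _)) (trans eq (+-identityʳ _))
        split true  eq = +-cancelʳ-≡ (x + 0) _ _ (begin
          y + total F f + (x + 0)    ≡⟨ cong₂ _+_ (+-comm y _) (+-identityʳ x) ⟩
          total F f + y + x          ≡⟨ +-assoc (total F f) y x ⟩
          total F f + (y + x)        ≡⟨ cong (total F f +_) (+-comm y x) ⟩
          total F f + (x + y)        ≡⟨ eq ⟩
          total F g + (x + 0)        ∎)

      lift-nonempty : ∀ {F} → Nonempty F → Nonempty (lift F)
      lift-nonempty (i , i∈F) = suc i , there i∈F

      lift-regular : ∀ {F} → TwoRegular G F → TwoRegular G′ (lift F)
      lift-regular {F} reg zero    = subst ZeroOrTwo (sym (deg-new (lookup F e) F)) (double (lookup F e))
        where
        double : ∀ b → ZeroOrTwo (b ⊙ 1 + b ⊙ 1)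
        double false = inj₁ refl
        double true  = inj₂ refl
      lift-regular {F} reg (suc v) = subst ZeroOrTwo (sym (deg-old F v)) (reg v)

      lift-⊆ : ∀ {K F} → K ⊆ F → lift K ⊆ lift F
      lift-⊆ {K} {F} K⊆F {suc i} (there i∈K) = there (K⊆F i∈K)
      lift-⊆ {K} {F} K⊆F {zero}  0∈ = lookup⇒[]= zero (lift F)
        ([]=⇒lookup (K⊆F (lookup⇒[]= e K ([]=⇒lookup 0∈))))

      -- The new vertex is incident only with the two halves of `e`, so degree 0 or 2 there means
      -- both or neither.
      is-lift : ∀ a F → ZeroOrTwo (deg G′ (a ∷ F) zero) → a ≡ lookup F e
      is-lift a F reg = equal a (lookup F e) (subst ZeroOrTwo (deg-new a F) reg)
        where
        equal : ∀ a b → ZeroOrTwo (a ⊙ 1 + b ⊙ 1) → a ≡ b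
        equal false false _ = refl
        equal true  true  _ = refl
        equal false true  (inj₁ ())
        equal false true  (inj₂ ())
        equal true  false (inj₁ ())
        equal true  false (inj₂ ())

    subdivide-catalogue : ∀ {hub Ks} → Catalogue G hub Ks → Catalogue G′ (suc hub) (map lift Ks)
    subdivide-catalogue {hub} {Ks} C = record
      { complete = complete′
      ; regular  = All.map⁺ (All.map (λ {K} (ne , reg) → lift-nonempty {K} ne , lift-regular {K} reg) C.regular)
      }
      where
      module C = Catalogue C
      complete′ : ∀ F → Nonempty F → (∀ v → v ≢ suc hub → ZeroOrTwo (deg G′ F v)) → Any (_⊆ F) (map lift Ks)
      complete′ (a ∷ F) ne reg with is-lift a F (reg zero λ ())
      ... | refl = Any.map⁺ (Any.map lift-⊆ (C.complete F (shrink ne)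
                     λ v v≢h → subst ZeroOrTwo (deg-old F v) (reg (suc v) (v≢h ∘ suc-injective))))
        where
        shrink : Nonempty (lift F) → Nonempty F
        shrink (zero  , 0∈)        = e , lookup⇒[]= e F ([]=⇒lookup 0∈)
        shrink (suc i , there i∈F) = i , i∈F

  -- Cycles

  map-unique-injective : ∀ {A B : Set} {f : A → B} {xs x y} → Unique (map f xs) →
                         x ∈ˡ xs → y ∈ˡ xs → f x ≡ f y → x ≡ y
  map-unique-injective {f = f} (fx∉ ∷ _) (here refl) (here refl) _ = refl
  map-unique-injective {f = f} (fx∉ ∷ _) (here refl) (there y∈)  eq = contradiction eq (All.lookup fx∉ (∈-map⁺ f y∈))
  map-unique-injective {f = f} (fy∉ ∷ _) (there x∈)  (here refl) eq = contradiction (sym eq) (All.lookup fy∉ (∈-map⁺ f x∈))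
  map-unique-injective (_ ∷ u)   (there x∈)  (there y∈)  eq = map-unique-injective u x∈ y∈ eq

  module _ {n m} {G : Graph n m} where
    open Subgraph

    module _ C (cycle : IsCycle G C) where
      private
        E = edges C

      cycle-deg : ∀ {v} → v ∈ vertices C → deg G E v ≡ 2
      cycle-deg {v} v∈C = trans (sym (degree≡deg G C v)) (proj₂ cycle v∈C)

      off-cycle-deg : ∀ {v} → ¬ v ∈ vertices C → deg G E v ≡ 0
      off-cycle-deg {v} v∉C = trans (total-cong E λ {e} e∈E → let (u∈C , w∈C) = closed C e∈E in
        incidence-zero (ends G e) (λ { refl → v∉C u∈C }) (λ { refl → v∉C w∈C })) (total-zero E λ _ → refl)

      cycle-regular : TwoRegular G E
      cycle-regular v with v ∈? vertices C
      ... | yes v∈C = inj₂ (cycle-deg v∈C)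
      ... | no  v∉C = inj₁ (off-cycle-deg v∉C)

      cycle-nonempty : Nonempty E
      cycle-nonempty = let (v , v∈C) = proj₁ (proj₁ cycle) in
        positive-total E _ (subst (0 <_) (sym (cycle-deg v∈C)) (s≤s z≤n))

      module _ {K} (K⊆E : K ⊆ E) (regular : TwoRegular G K) where
        private
          Touched : Fin n → Set
          Touched v = deg G K v ≡ 2

          touch : ∀ {e v} → e ∈ K → 0 < incidence (ends G e) v → Touched v
          touch {v = v} e∈K 0<i = positive⇒two (regular v) (<-≤-trans 0<i (∈⇒≤total _ e∈K))

          -- At a touched vertex `K` already has degree 2, the most that `E` can have, so no edge of
          -- `E` is left over.
          saturated : ∀ {e v} → Touched v → e ∈ E → 0 < incidence (ends G e) v → e ∈ K
          saturated {v = v} touched = total-saturated (λ e → incidence (ends G e) v) K⊆E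
            (subst (deg G E v ≤_) (sym touched) (≤2 (cycle-regular v)))
            where
            ≤2 : ∀ {k} → ZeroOrTwo k → k ≤ 2
            ≤2 (inj₁ refl) = z≤n
            ≤2 (inj₂ refl) = ≤-refl

          walk : ∀ {u v} → Star (Adjacent G C) u v → Touched u → Touched v
          walk ε touched = touched
          walk {u} ((e , e∈E , inj₁ refl) ◅ path) touched =
            walk path (touch (saturated touched e∈E (incidence₁ (ends G e))) (incidence₂ (ends G e)))
          walk {u} ((e , e∈E , inj₂ refl) ◅ path) touched =
            walk path (touch (saturated touched e∈E (incidence₂ (ends G e))) (incidence₁ (ends G e)))

        -- K is closed under adjacency in the connected subgraph C.
        cycle-minimal : Nonempty K → E ≡ K
        cycle-minimal (e₀ , e₀∈K) = ⊆-antisym E⊆K K⊆E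
          where
          E⊆K : E ⊆ K
          E⊆K {e} e∈E = saturated (walk path (touch e₀∈K (incidence₁ (ends G e₀)))) e∈E (incidence₁ (ends G e))
            where path = proj₂ (proj₁ cycle) (proj₁ (closed C (K⊆E e₀∈K))) (proj₁ (closed C e∈E))

    -- The vertices of a cycle are exactly those of nonzero degree, hence determined by the edges.
    same-edges : ∀ C D → IsCycle G C → IsCycle G D → edges C ≡ edges D → _≈_ G C D
    same-edges C D c d eq = ⊆-antisym (sub C D c d eq) (sub D C d c (sym eq)) , eq
      where
      sub : ∀ C D → IsCycle G C → IsCycle G D → edges C ≡ edges D → vertices C ⊆ vertices D
      sub C D c d eq {v} v∈C with v ∈? vertices D
      ... | yes v∈D = v∈D
      ... | no  v∉D = case trans (sym (cycle-deg C c v∈C)) (trans (cong (λ E → deg G E v) eq) (off-cycle-deg D d v∉D)) of λ ()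

    -- Completeness puts a listed set inside the cycle, and minimality of cycles among 2-regular
    -- sets makes the two equal.
    catalogue-cycles : ∀ {hub Ks} → Catalogue G hub Ks → ∀ C → IsCycle G C → edges C ∈ˡ Ks
    catalogue-cycles K C c
      with find (Catalogue.complete K (edges C) (cycle-nonempty C c) (λ v _ → cycle-regular C c v))
    ... | (F , F∈Ks , F⊆C) = let (ne , reg) = All.lookup (Catalogue.regular K) F∈Ks in
      subst (_∈ˡ _) (sym (cycle-minimal C c F⊆C reg ne)) F∈Ks

    distinctCycleLengths : ∀ {hub Ks} → Catalogue G hub Ks → Unique (map ∣_∣ Ks) → DistinctCycleLengths G
    distinctCycleLengths K unique C D c d C≉D eq =
      C≉D (same-edges C D c d (map-unique-injective unique (catalogue-cycles K C c) (catalogue-cycles K D d) eq))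

  -- Weighted graphs and their realisation by subdivision

  -- A graph with positive edge weights w, to be subdivided into paths with
  -- w e edges; ls lists the weights of its cycles, x is its cyclomatic number
  -- and W its total weight.
  record Weighted (ls : List ℕ) (x W : ℕ) : Set where
    field
      {n m}     : ℕ
      G         : Graph n m
      hub       : Fin n
      Ks        : List (Subset m)
      catalogue : Catalogue G hub Ks
      w         : Fin m → ℕ
      positive  : ∀ e → 0 < w e
      lengths   : map (λ K → total K w) Ks ≡ ls
      size      : suc m ≡ n + x
      weight    : total ⊤ w ≡ W

  private
    module _ {n m} (G : Graph n m) (w : Fin m → ℕ) (e : Fin m) where
      -- Subdividing `e` splits off one unit: the new edge has weight 1 and `e` keeps the rest.
      cut : Fin m → ℕ
      cut i with i ≟ᶠ e
      ... | yes _ = pred (w e)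
      ... | no  _ = w i

      cut-e : cut e ≡ pred (w e)
      cut-e with e ≟ᶠ e
      ... | yes _   = refl
      ... | no  e≢e = contradiction refl e≢e

      cut-other : ∀ i → i ≢ e → cut i ≡ w i
      cut-other i i≢e with i ≟ᶠ e
      ... | yes i≡e = contradiction i≡e i≢e
      ... | no  _   = refl

      cut-positive : (∀ i → 0 < w i) → 1 < w e → ∀ i → 0 < (1 ◂ cut) i
      cut-positive pos 1<we zero    = s≤s z≤n
      cut-positive pos 1<we (suc i) with i ≟ᶠ e
      ... | yes _ = pred-mono-≤ 1<we
      ... | no  _ = pos i

      cut-total : 1 < w e → ∀ F → total (lift G e F) (1 ◂ cut) ≡ total F w
      cut-total 1<we F = split (lookup F e) (w e) 1<we
        (trans (total-update F cut w e cut-other) (cong (λ z → total F w + lookup F e ⊙ z) cut-e))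
        where
        split : ∀ b k → 1 < k → total F cut + b ⊙ k ≡ total F w + b ⊙ pred k →
                b ⊙ 1 + total F cut ≡ total F w
        split false k       _ eq = trans (sym (+-identityʳ _)) (trans eq (+-identityʳ _))
        split true  (suc k) _ eq = +-cancelʳ-≡ k _ _ (trans (sym (+-suc (total F cut) k)) eq)

  refine : ∀ {ls x W} (N : Weighted ls x W) → let open Weighted N in
           ∀ e → 1 < w e → Weighted ls x W
  refine N e 1<we = record
    { G         = subdivide G e
    ; hub       = suc hub
    ; Ks        = map (lift G e) Ks
    ; catalogue = subdivide-catalogue G e catalogue
    ; w         = 1 ◂ cut G w e
    ; positive  = cut-positive G w e positive 1<we
    ; lengths   = trans (sym (map-∘ Ks)) (trans (map-cong (cut-total G w e 1<we) Ks) lengths)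
    ; size      = cong suc size
    ; weight    = trans (cong (λ b → b ⊙ 1 + total ⊤ (cut G w e)) (sym (lookup-replicate e true)))
                    (trans (cut-total G w e 1<we ⊤) weight)
    }
    where open Weighted N

  m≤total : ∀ {m} (w : Fin m → ℕ) → (∀ e → 0 < w e) → m ≤ total ⊤ w
  m≤total {zero}  w pos = z≤n
  m≤total {suc m} w pos = +-mono-≤ (pos zero) (m≤total (w ∘ suc) (pos ∘ suc))

  m≤W : ∀ {ls x W} (N : Weighted ls x W) → Weighted.m N ≤ W
  m≤W N = subst (_ ≤_) weight (m≤total w positive)
    where open Weighted N

  -- With unit weights the graph has W edges, and the equation is Euler's relation, which fixes `n`.
  Realised : List ℕ → ℕ → ℕ → Set
  Realised ls x W = ∃ λ n → suc W ≡ n + x × (Unique ls → Σ (Graph n W) DistinctCycleLengths)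

  unit-weights : ∀ {ls x W} (N : Weighted ls x W) → let open Weighted N in
                 (∀ e → w e ≡ 1) → Realised ls x W
  unit-weights {ls} {x} {W} N w≡1 = n , subst (λ k → suc k ≡ n + x) m≡W size , λ unique →
    subst (λ k → Σ (Graph n k) DistinctCycleLengths) m≡W
      (G , distinctCycleLengths catalogue (subst Unique (sym lengths′) unique))
    where
    open Weighted N
    card : ∀ F → ∣ F ∣ ≡ total F w
    card F = trans (∣∣≡total F) (total-cong F λ {e} _ → sym (w≡1 e))
    m≡W : m ≡ W
    m≡W = trans (sym (∣⊤∣≡n m)) (trans (card ⊤) weight)
    lengths′ : map ∣_∣ Ks ≡ ls
    lengths′ = trans (map-cong card Ks) lengths

  -- Each refinement adds an edge and preserves the total weight, while positivity keeps the number
  -- of edges at most W. Thus `d` bounds the refinements still possible.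
  realise : ∀ {ls x W} → Weighted ls x W → Realised ls x W
  realise {W = W} N = go W N (m≤n+m W _)
    where
    go : ∀ {ls x W} d (N : Weighted ls x W) → W ≤ Weighted.m N + d → Realised ls x W
    go d N W≤m+d with any? (λ e → 1 <? Weighted.w N e)
    ... | no  none = unit-weights N λ e → ≤-antisym (≮⇒≥ λ 1<we → none (e , 1<we)) (Weighted.positive N e)
    go zero N W≤m+0 | yes (e , 1<we) = contradiction
      (≤-trans (m≤W (refine N e 1<we)) (≤-trans W≤m+0 (≤-reflexive (+-identityʳ _)))) 1+n≰n
    go (suc d) N W≤m+d | yes (e , 1<we) = go d (refine N e 1<we) (≤-trans W≤m+d (≤-reflexive (+-suc _ d)))

  -- Rings of digons

  module Ring {A : Set} (_∙_ : A → A → A) (ε : A) where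
    -- One entry per choice of branches. If the branch differences are decreasing powers of two
    -- ending in 1, the list comes out as consecutive lengths in increasing order.
    longs : List (A × A) → List A
    longs []             = ε ∷ []
    longs ((β , γ) ∷ ds) = map (β ∙_) (longs ds) ++ map (γ ∙_) (longs ds)

    digons : List (A × A) → List A
    digons = map λ (β , γ) → β ∙ γ

    digonWeight : List (A × A) → A
    digonWeight []             = ε
    digonWeight ((β , γ) ∷ ds) = β ∙ (γ ∙ digonWeight ds)

    ringLengths : List (A × A) → A → List A
    ringLengths ds p = map (p ∙_) (longs ds) ++ digons ds

    ringWeight : List (A × A) → A → A
    ringWeight ds p = p ∙ digonWeight ds

  open Ring _+_ 0

  private
    -- A ring under construction; the weight of edge zero is still undecided.
    record Unclosed (ds : List (ℕ × ℕ)) (ls : List ℕ) (x W : ℕ) : Set where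
      field
        {n m}    : ℕ
        G        : Graph n (suc m)
        hub      : Fin n
        T R      : List (Subset m)
        opened   : Opened G hub T R
        w        : Fin m → ℕ
        positive : ∀ e → 0 < w e
        lengthsT : map (λ K → total K w) T ≡ longs ds
        lengthsR : map (λ K → total K w) R ≡ digons ds ++ ls
        size     : suc (suc m) ≡ n + suc (List.length ds + x)
        weight   : total ⊤ w ≡ digonWeight ds + W

    unclosed-[] : ∀ {ls x W} → Weighted ls x W → Unclosed [] ls x W
    unclosed-[] {x = x} N = record
      { G        = addLoop G hub
      ; opened   = addLoop-opened catalogue
      ; positive = positive
      ; lengthsT = cong (_∷ []) (total-⊥ _ w)
      ; lengthsR = lengths
      ; size     = trans (cong suc size) (sym (+-suc n x))
      ; weight   = weight
      }
      where open Weighted N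

    unclosed-∷ : ∀ {β γ ds ls x W} → 0 < β × 0 < γ → Unclosed ds ls x W → Unclosed ((β , γ) ∷ ds) ls x W
    unclosed-∷ {β} {γ} {ds} {ls} {x} {W} (0<β , 0<γ) U = record
      { G        = insertDigon G
      ; opened   = insertDigon-opened opened
      ; positive = λ { zero → 0<β ; (suc zero) → 0<γ ; (suc (suc e)) → positive e }
      ; lengthsT = begin
          map ⟦_⟧′ (map (λ K → true ∷ false ∷ K) T ++ map (λ K → false ∷ true ∷ K) T)
            ≡⟨ map-++ ⟦_⟧′ (map (λ K → true ∷ false ∷ K) T) _ ⟩
          map ⟦_⟧′ (map (λ K → true ∷ false ∷ K) T) ++ map ⟦_⟧′ (map (λ K → false ∷ true ∷ K) T)
            ≡⟨ cong₂ _++_ (trans (sym (map-∘ T)) (map-∘ T)) (trans (sym (map-∘ T)) (map-∘ T)) ⟩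
          map (β +_) (map ⟦_⟧ T) ++ map (γ +_) (map ⟦_⟧ T)
            ≡⟨ cong (λ l → map (β +_) l ++ map (γ +_) l) lengthsT ⟩
          longs ((β , γ) ∷ ds) ∎
      ; lengthsR = cong₂ _∷_ (cong (β +_) (trans (cong (γ +_) (total-⊥ _ w)) (+-identityʳ γ)))
          (trans (sym (map-∘ R)) lengthsR)
      ; size     = trans (cong (2 +_) size) (cong suc (sym (+-suc n _)))
      ; weight   = begin
          β + (γ + total ⊤ w)               ≡⟨ cong (λ z → β + (γ + z)) weight ⟩
          β + (γ + (digonWeight ds + W))    ≡⟨ cong (β +_) (+-assoc γ _ W) ⟨
          β + (γ + digonWeight ds + W)      ≡⟨ +-assoc β _ W ⟨
          β + (γ + digonWeight ds) + W      ∎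
      }
      where
      open Unclosed U
      open ≡-Reasoning
      ⟦_⟧ : Subset m → ℕ
      ⟦ K ⟧ = total K w
      ⟦_⟧′ : Subset (suc (suc m)) → ℕ
      ⟦ K ⟧′ = total K (β ◂ γ ◂ w)

    unclosed : ∀ {ds ls x W} → All (λ (β , γ) → 0 < β × 0 < γ) ds → Weighted ls x W → Unclosed ds ls x W
    unclosed []           N = unclosed-[] N
    unclosed (pos ∷ poss) N = unclosed-∷ pos (unclosed poss N)

  addRing : ∀ {ds p ls x W} → All (λ (β , γ) → 0 < β × 0 < γ) ds → 0 < p → Weighted ls x W →
            Weighted (ringLengths ds p ++ ls) (suc (List.length ds + x)) (ringWeight ds p + W)
  addRing {ds} {p} {ls} {x} {W} pos 0<p N = record
    { catalogue = close opened
    ; w         = p ◂ w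
    ; positive  = λ { zero → 0<p ; (suc e) → positive e }
    ; lengths   = begin
        map ⟦_⟧′ (map (true ∷_) T ++ map (false ∷_) R)
          ≡⟨ map-++ ⟦_⟧′ (map (true ∷_) T) _ ⟩
        map ⟦_⟧′ (map (true ∷_) T) ++ map ⟦_⟧′ (map (false ∷_) R)
          ≡⟨ cong₂ _++_ (trans (sym (map-∘ T)) (map-∘ T)) (sym (map-∘ R)) ⟩
        map (p +_) (map ⟦_⟧ T) ++ map ⟦_⟧ R
          ≡⟨ cong₂ (λ t r → map (p +_) t ++ r) lengthsT lengthsR ⟩
        map (p +_) (longs ds) ++ digons ds ++ ls
          ≡⟨ ++-assoc (map (p +_) (longs ds)) (digons ds) ls ⟨
        ringLengths ds p ++ ls ∎
    ; size      = size
    ; weight    = trans (cong (p +_) weight) (sym (+-assoc p _ W))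
    }
    where
    open Unclosed (unclosed pos N)
    open ≡-Reasoning
    ⟦_⟧ : Subset m → ℕ
    ⟦ K ⟧ = total K w
    ⟦_⟧′ : Subset (suc m) → ℕ
    ⟦ K ⟧′ = total K (p ◂ w)

  point : Weighted [] 0 0
  point = record
    { n         = 1
    ; m         = 0
    ; G         = record { ends = λ () }
    ; hub       = zero
    ; catalogue = record { complete = λ { _ (() , _) } ; regular = [] }
    ; w         = λ ()
    ; positive  = λ ()
    ; lengths   = refl
    ; size      = refl
    ; weight    = refl
    }

module Design where
  open Cycles using (Weighted; module Ring; addRing; point; Realised; realise)
  open import Data.Bool.Base using (if_then_else_)
  open import Data.Fin using (#_)
  open import Data.Fin.Base as Fin using (Fin)
  import Data.Fin.Properties as Fin
  open import Data.List.Base as List using (List; []; _∷_; _++_; map; concatMap; upTo)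
  open import Data.List.Membership.Propositional using (_∈_)
  open import Data.List.Membership.Propositional.Properties using (∈-++⁻; ∈-map⁻)
  open import Data.List.Properties using (map-++; map-∘; map-cong; ++-assoc; length-map)
  open import Data.List.Relation.Unary.All as All using (All; []; _∷_)
  import Data.List.Relation.Unary.All.Properties as All
  open import Data.List.Relation.Unary.Unique.Propositional using (Unique; []; _∷_)
  import Data.List.Relation.Unary.Unique.Propositional.Properties as Unique
  open import Data.Nat.Base
    using (zero; suc; _+_; _*_; _∸_; _^_; _/_; _<ᵇ_; _≤_; _<_; z≤n; s≤s)
  open import Data.Nat.Properties
  open import Data.Nat.Tactic.RingSolver using (solve-∀)
  open import Data.Product.Base as Product using (Σ; ∃; _×_; _,_)
  open import Data.Sum.Base using (inj₁; inj₂)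
  open import Data.Vec.Base using ([]; _∷_; lookup)
  open import Function.Base using (_∘_)
  open import Relation.Binary.Definitions using (tri<; tri≈; tri>)
  open import Relation.Binary.PropositionalEquality
  open import Relation.Nullary.Decidable.Core using (toWitness; _×-dec_; _→-dec_)
  open import Relation.Nullary.Negation.Core using (contradiction)

  -- Families of rings, over numbers and over affine forms

  module Rings {A : Set} (_∙_ : A → A → A) (ε : A) where
    open Ring _∙_ ε

    ringsLengths : List (List (A × A) × A) → List A
    ringsLengths []             = []
    ringsLengths ((ds , p) ∷ bs) = ringLengths ds p ++ ringsLengths bs

    ringsWeight : List (List (A × A) × A) → A
    ringsWeight []             = ε
    ringsWeight ((ds , p) ∷ bs) = ringWeight ds p ∙ ringsWeight bs

  excess : {A : Set} → List (List (A × A) × A) → ℕ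
  excess []              = 0
  excess ((ds , p) ∷ bs) = suc (List.length ds) + excess bs

  AllPositive : {A : Set} → (A → Set) → List (List (A × A) × A) → Set
  AllPositive P = All λ (ds , p) → All (λ (β , γ) → P β × P γ) ds × P p

  open Rings _+_ 0

  addRings : ∀ {bs ls x W} → AllPositive (0 <_) bs → Weighted ls x W →
             Weighted (ringsLengths bs ++ ls) (excess bs + x) (ringsWeight bs + W)
  addRings []                                              N = N
  addRings {(ds , p) ∷ bs} {ls} {x} {W} ((pos , 0<p) ∷ poss) N
    rewrite ++-assoc (Ring.ringLengths _+_ 0 ds p) (ringsLengths bs) ls
          | +-assoc (List.length ds) (excess bs) x
          | +-assoc (Ring.ringWeight _+_ 0 ds p) (ringsWeight bs) W
    = addRing pos 0<p (addRings poss N)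

  -- Lengths in round r, with q rounds to follow, are affine in r and q.

  record Form : Set where
    constructor form
    field a b c : ℕ

  _⊕_ : Form → Form → Form
  form a b c ⊕ form a′ b′ c′ = form (a + a′) (b + b′) (c + c′)

  0F : Form
  0F = form 0 0 0

  module Eval (r q : ℕ) where
    ⟦_⟧ : Form → ℕ
    ⟦ form a b c ⟧ = a * r + b * q + c

    ⟦⟧-⊕ : ∀ x y → ⟦ x ⊕ y ⟧ ≡ ⟦ x ⟧ + ⟦ y ⟧
    ⟦⟧-⊕ (form a b c) (form a′ b′ c′) = lemma a b c a′ b′ c′ r q
      where
      lemma : ∀ a b c a′ b′ c′ r q → (a + a′) * r + (b + b′) * q + (c + c′) ≡ a * r + b * q + c + (a′ * r + b′ * q + c′)
      lemma = solve-∀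

    ⟦_⟧² : Form × Form → ℕ × ℕ
    ⟦_⟧² = Product.map ⟦_⟧ ⟦_⟧

    ⟦_⟧ʳ : List (Form × Form) × Form → List (ℕ × ℕ) × ℕ
    ⟦ ds , p ⟧ʳ = map ⟦_⟧² ds , ⟦ p ⟧

    private
      module F = Ring _⊕_ 0F
      module N = Ring _+_ 0
      module Fs = Rings _⊕_ 0F

      map-⊕ : ∀ x ys → map ⟦_⟧ (map (x ⊕_) ys) ≡ map (⟦ x ⟧ +_) (map ⟦_⟧ ys)
      map-⊕ x ys = trans (sym (map-∘ ys)) (trans (map-cong (⟦⟧-⊕ x) ys) (map-∘ ys))

      longs-eval : ∀ ds → map ⟦_⟧ (F.longs ds) ≡ N.longs (map ⟦_⟧² ds)
      longs-eval []             = refl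
      longs-eval ((β , γ) ∷ ds) = trans (map-++ ⟦_⟧ (map (β ⊕_) (F.longs ds)) _) (cong₂ _++_
        (trans (map-⊕ β (F.longs ds)) (cong (map (⟦ β ⟧ +_)) (longs-eval ds)))
        (trans (map-⊕ γ (F.longs ds)) (cong (map (⟦ γ ⟧ +_)) (longs-eval ds))))

      digons-eval : ∀ ds → map ⟦_⟧ (F.digons ds) ≡ N.digons (map ⟦_⟧² ds)
      digons-eval ds = trans (sym (map-∘ ds)) (trans (map-cong (λ (β , γ) → ⟦⟧-⊕ β γ) ds) (map-∘ ds))

      digonWeight-eval : ∀ ds → ⟦ F.digonWeight ds ⟧ ≡ N.digonWeight (map ⟦_⟧² ds)
      digonWeight-eval []             = refl
      digonWeight-eval ((β , γ) ∷ ds) = trans (⟦⟧-⊕ β _)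
        (cong (⟦ β ⟧ +_) (trans (⟦⟧-⊕ γ _) (cong (⟦ γ ⟧ +_) (digonWeight-eval ds))))

    -- Lengths are built by addition alone and evaluation is additive, so an identity between forms
    -- yields one for all `r` and `q`.
    ringsLengths-eval : ∀ bs → map ⟦_⟧ (Fs.ringsLengths bs) ≡ ringsLengths (map ⟦_⟧ʳ bs)
    ringsLengths-eval []              = refl
    ringsLengths-eval ((ds , p) ∷ bs) =
      trans (map-++ ⟦_⟧ (F.ringLengths ds p) _) (cong₂ _++_
        (trans (map-++ ⟦_⟧ (map (p ⊕_) (F.longs ds)) _) (cong₂ _++_
          (trans (map-⊕ p (F.longs ds)) (cong (map (⟦ p ⟧ +_)) (longs-eval ds)))
          (digons-eval ds)))
        (ringsLengths-eval bs))

    ringsWeight-eval : ∀ bs → ⟦ Fs.ringsWeight bs ⟧ ≡ ringsWeight (map ⟦_⟧ʳ bs)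
    ringsWeight-eval []              = refl
    ringsWeight-eval ((ds , p) ∷ bs) = trans (⟦⟧-⊕ (F.ringWeight ds p) _) (cong₂ _+_
      (trans (⟦⟧-⊕ p _) (cong (⟦ p ⟧ +_) (digonWeight-eval ds))) (ringsWeight-eval bs))

    excess-eval : ∀ bs → excess (map ⟦_⟧ʳ bs) ≡ excess bs
    excess-eval []              = refl
    excess-eval ((ds , p) ∷ bs) = cong₂ (λ x y → suc x + y) (length-map ⟦_⟧² ds) (excess-eval bs)

    positive-eval : ∀ {bs} → AllPositive (λ x → 0 < Form.c x) bs → AllPositive (0 <_) (map ⟦_⟧ʳ bs)
    positive-eval = All.map⁺ ∘ All.map λ {(_ , p)} (pos , 0<p) →
      All.map⁺ (All.map (λ {(β , γ)} (0<β , 0<γ) → ⟦⟧-positive β 0<β , ⟦⟧-positive γ 0<γ) pos) , ⟦⟧-positive p 0<p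
      where
      ⟦⟧-positive : ∀ x → 0 < Form.c x → 0 < ⟦ x ⟧
      ⟦⟧-positive x 0<c = m≤n⇒m≤o+n _ 0<c

  -- The rings of one round

  -- With T rounds, region j is the set of lengths from `left j * T + 1` to `right j * T`. Region 0
  -- holds plain cycles, regions 1 and 2 the digons and five more plain cycles, regions 3, 4 and 5
  -- the cycles through the hub of rings with 2, 3 and 5 digons. The cut at 36 keeps four of the
  -- five digons of the largest ring short: half-digons with coefficient 50 / 2 each would exceed
  -- 114, whereas 4 * 18 + 25 = 97. The ends of regions 1 and 2 are even, so that digons can be
  -- halved.
  left right : Fin 6 → ℕ
  left = lookup (0  ∷ 26 ∷ 36 ∷ 50 ∷ 66 ∷ 82  ∷ [])
  right  = lookup (26 ∷ 36 ∷ 50 ∷ 66 ∷ 82 ∷ 114 ∷ [])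

  region : ℕ → Fin 6
  region k =
    if k <ᵇ 26 then # 0 else if k <ᵇ 36 then # 1 else if k <ᵇ 50 then # 2 else
    if k <ᵇ 66 then # 3 else if k <ᵇ 82 then # 4 else # 5

  -- In round r, with q rounds to follow, slot k of region j holds a cycle of
  -- length left j * (r + q) + (right j - left j) * r + k + 1.
  slot : ℕ → Form
  slot k = form (right (region k)) (left (region k)) (suc k)

  -- In the design below, halving and ∸ (here and in ringForm) are exact:
  -- otherwise rings-lengths would fail.
  splitDigon : ℕ → Form → Form × Form
  splitDigon δ (form a b c) = form (a / 2) (b / 2) ((c ∸ δ) / 2) , form (a / 2) (b / 2) ((c + δ) / 2)

  digonForms : List ℕ → List (Form × Form)
  digonForms []       = []
  digonForms (k ∷ ks) = splitDigon (2 ^ List.length ks) (slot k) ∷ digonForms ks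

  _⊖_ : Form → Form → Form
  form a b c ⊖ form a′ b′ c′ = form (a ∸ a′) (b ∸ b′) (c ∸ c′)

  ringForm : ℕ × List ℕ → List (Form × Form) × Form
  ringForm (base , ks) = digonForms ks , List.foldl (λ p (β , _) → p ⊖ β) (slot base) (digonForms ks)

  ringSlots : ℕ × List ℕ → List ℕ
  ringSlots (base , ks) = map (base +_) (upTo (2 ^ List.length ks)) ++ ks

  -- Each entry gives the first slot of a ring's cycles through the hub, then its digon slots by
  -- decreasing difference. A digon with difference δ needs k + 1 to have the parity of δ, so the
  -- last digon sits in an even slot and the others in odd ones. From 26 to 49 the rings take all
  -- twelve odd and seven even slots; the five even ones left over become plain cycles.
  design : List (ℕ × List ℕ)
  design =
    (82 , 33 ∷ 31 ∷ 29 ∷ 27 ∷ 36 ∷ []) ∷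
    (66 , 37 ∷ 35 ∷ 38 ∷ []) ∷ (74 , 41 ∷ 39 ∷ 40 ∷ []) ∷
    (50 , 43 ∷ 42 ∷ []) ∷ (54 , 45 ∷ 44 ∷ []) ∷ (58 , 47 ∷ 46 ∷ []) ∷ (62 , 49 ∷ 48 ∷ []) ∷
    map (_, []) (26 ∷ 28 ∷ 30 ∷ 32 ∷ 34 ∷ upTo 26)

  rings : List (List (Form × Form) × Form)
  rings = map ringForm design

  slots : List ℕ
  slots = concatMap ringSlots design

  rings-lengths : Rings.ringsLengths _⊕_ 0F rings ≡ map slot slots
  rings-lengths = refl

  rings-weight : Rings.ringsWeight _⊕_ 0F rings ≡ form 1838 861 1372
  rings-weight = refl

  rings-positive : AllPositive (λ x → 0 < Form.c x) rings
  rings-positive = toWitness {a? = All.all? (λ (ds , p) →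
    All.all? (λ (β , γ) → 0 <? Form.c β ×-dec 0 <? Form.c γ) ds ×-dec 0 <? Form.c p) rings} _

  slots-unique : Unique slots
  slots-unique = toWitness {a? = unique? slots} _
    where open import Data.List.Relation.Unary.Unique.DecPropositional _≟_ using (unique?)

  slots-bounded : All (λ k → left (region k) ≤ k × k < right (region k)) slots
  slots-bounded = toWitness {a? = All.all? (λ k → left (region k) ≤? k ×-dec k <? right (region k)) slots} _

  right≤left : ∀ i j → i Fin.< j → right i ≤ left j
  right≤left = toWitness {a? = Fin.all? λ i → Fin.all? λ j → (i Fin.<? j) →-dec (right i ≤? left j)} _

  left≤right : ∀ i → left i ≤ right i
  left≤right = toWitness {a? = Fin.all? λ i → left i ≤? right i} _

  right≤114 : ∀ i → right i ≤ 114
  right≤114 = toWitness {a? = Fin.all? λ i → right i ≤? 114} _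

  slotLength : ℕ → ℕ → ℕ → ℕ
  slotLength r q k = Eval.⟦_⟧ r q (slot k)

  addForms : ∀ {bs ks v ls x W} r q →
             Rings.ringsLengths _⊕_ 0F bs ≡ map slot ks → Rings.ringsWeight _⊕_ 0F bs ≡ v →
             AllPositive (λ y → 0 < Form.c y) bs → Weighted ls x W →
             Weighted (map (slotLength r q) ks ++ ls) (excess bs + x) (Eval.⟦_⟧ r q v + W)
  addForms {bs} {ks} {v} {ls} {x} {W} r q lengths weight pos N
    rewrite sym (Eval.excess-eval r q bs) =
    subst₂ (λ l W′ → Weighted (l ++ ls) (excess (map ⟦_⟧ʳ bs) + x) (W′ + W))
      (trans (sym (ringsLengths-eval bs)) (trans (cong (map ⟦_⟧) lengths) (sym (map-∘ ks))))
      (trans (sym (ringsWeight-eval bs)) (cong ⟦_⟧ weight))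
      (addRings (positive-eval pos) N)
    where open Eval r q

  addRound : ∀ {ls x W} r q → Weighted ls x W →
             Weighted (map (slotLength r q) slots ++ ls) (57 + x) (1838 * r + 861 * q + 1372 + W)
  addRound r q = addForms {rings} {slots} r q rings-lengths rings-weight rings-positive

  -- The union of all rounds: weight and distinct lengths

  roundsLengths : (q r : ℕ) → List ℕ
  roundsLengths zero    r = []
  roundsLengths (suc q) r = map (slotLength r q) slots ++ roundsLengths q (suc r)

  roundsWeight : (q r : ℕ) → ℕ
  roundsWeight zero    r = 0
  roundsWeight (suc q) r = 1838 * r + 861 * q + 1372 + roundsWeight q (suc r)

  rounds : ∀ q r → Weighted (roundsLengths q r) (q * 57) (roundsWeight q r)
  rounds zero    r = point
  rounds (suc q) r = addRound r q (rounds q (suc r))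

  -- Twice an arithmetic series, with 2699 = 1838 + 861: its quadratic part is 2699 q (q - 1), whose
  -- negative term stands on the left.
  roundsWeight-closed : ∀ q r → 2 * roundsWeight q r + 2699 * q ≡ r * (3676 * q) + 2699 * (q * q) + 2744 * q
  roundsWeight-closed zero    r = sym (cong (λ z → z + 0 + 0) (*-zeroʳ r))
  roundsWeight-closed (suc q) r = begin
    2 * (1838 * r + 861 * q + 1372 + V) + 2699 * suc q       ≡⟨ before r q V ⟩
    (2 * V + 2699 * q) + (3676 * r + 1722 * q + 5443)        ≡⟨ cong (_+ (3676 * r + 1722 * q + 5443)) (roundsWeight-closed q (suc r)) ⟩
    (suc r * (3676 * q) + 2699 * (q * q) + 2744 * q) + (3676 * r + 1722 * q + 5443)
                                                             ≡⟨ after r q ⟩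
    r * (3676 * suc q) + 2699 * (suc q * suc q) + 2744 * suc q ∎
    where
    open ≡-Reasoning
    V = roundsWeight q (suc r)
    before : ∀ r q V → 2 * (1838 * r + 861 * q + 1372 + V) + 2699 * suc q ≡ (2 * V + 2699 * q) + (3676 * r + 1722 * q + 5443)
    before = solve-∀
    after : ∀ r q → (suc r * (3676 * q) + 2699 * (q * q) + 2744 * q) + (3676 * r + 1722 * q + 5443) ≡
                    r * (3676 * suc q) + 2699 * (suc q * suc q) + 2744 * suc q
    after = solve-∀

  -- The lengths are lexicographically increasing in region, round and slot.

  Bounded : ℕ → Set
  Bounded k = left (region k) ≤ k × k < right (region k)

  -- Both coefficients of the lower slot are at most `right i`, and both of the upper slot are at
  -- least `left j`; the sum `r + q` is common to the two rounds.
  region-< : ∀ {r q r′ q′ k k′} → r + q ≡ r′ + q′ → Bounded k → Bounded k′ →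
             region k Fin.< region k′ → slotLength r q k < slotLength r′ q′ k′
  region-< {r} {q} {r′} {q′} {k} {k′} eq (_ , k<) (≤k′ , _) i<j = +-mono-≤-< (begin
    right i * r + left i * q      ≤⟨ +-monoʳ-≤ (right i * r) (*-monoˡ-≤ q (left≤right i)) ⟩
    right i * r + right i * q       ≡⟨ *-distribˡ-+ (right i) r q ⟨
    right i * (r + q)              ≡⟨ cong (right i *_) eq ⟩
    right i * (r′ + q′)            ≤⟨ *-monoˡ-≤ (r′ + q′) (right≤left i j i<j) ⟩
    left j * (r′ + q′)           ≡⟨ *-distribˡ-+ (left j) r′ q′ ⟩
    left j * r′ + left j * q′   ≤⟨ +-monoˡ-≤ (left j * q′) (*-monoˡ-≤ r′ (left≤right j)) ⟩
    right j * r′ + left j * q′    ∎)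
    (s≤s (<-≤-trans k< (≤-trans (right≤left i j i<j) ≤k′)))
    where
    open ≤-Reasoning
    i = region k
    j = region k′

  -- Each later round shifts a region by its width `right j - left j`, which exceeds every
  -- difference of two slots in it.
  round-< : ∀ {r q r′ q′ k k′} → r + q ≡ r′ + q′ → Bounded k → Bounded k′ →
            region k ≡ region k′ → r < r′ → slotLength r q k < slotLength r′ q′ k′
  round-< {r} {q} {r′} {q′} {k} {k′} eq (_ , k<) (≤k′ , _) i≡j r<r′ with m≤n⇒∃[o]m+o≡n r<r′
  ... | d , refl with +-cancelˡ-≡ r q (suc d + q′) (trans eq (trans (cong (_+ q′) (sym (+-suc r d))) (+-assoc r (suc d) q′)))
  ... | refl rewrite i≡j = begin-strict
    t * r + s * (suc d + q′) + suc k                    ≡⟨ before t r s d q′ k ⟩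
    t * r + s * q′ + s * d + (suc s + k)                <⟨ +-mono-≤-< (+-monoʳ-≤ (t * r + s * q′) (*-monoˡ-≤ d (left≤right j))) (s≤s (≤-<-trans (+-monoˡ-≤ k ≤k′) (+-monoʳ-< k′ k<))) ⟩
    t * r + s * q′ + t * d + (suc k′ + t)               ≡⟨ after t r s d q′ k′ ⟩
    t * (suc r + d) + s * q′ + suc k′                   ∎
    where
    open ≤-Reasoning
    j = region k′
    s = left j
    t = right j
    before : ∀ t r s d q k → t * r + s * (suc d + q) + suc k ≡ t * r + s * q + s * d + (suc s + k)
    before = solve-∀
    after : ∀ t r s d q k → t * r + s * q + t * d + (suc k + t) ≡ t * (suc r + d) + s * q + suc k
    after = solve-∀

  slotLength-round-≢ : ∀ {r q r′ q′ k k′} → r + q ≡ r′ + q′ → Bounded k → Bounded k′ →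
                       r < r′ → slotLength r q k ≢ slotLength r′ q′ k′
  slotLength-round-≢ {r} {q} {r′} {q′} {k} {k′} eq bk bk′ r<r′ with Fin.<-cmp (region k) (region k′)
  ... | tri< i<j _ _ = <⇒≢ (region-< {r} {q} {r′} eq bk bk′ i<j)
  ... | tri≈ _ i≡j _ = <⇒≢ (round-< {r} {q} {r′} eq bk bk′ i≡j r<r′)
  ... | tri> _ _ j<i = ≢-sym (<⇒≢ (region-< {r′} {q′} {r} (sym eq) bk′ bk j<i))

  slotLength-injective : ∀ {r q k k′} → Bounded k → Bounded k′ → slotLength r q k ≡ slotLength r q k′ → k ≡ k′
  slotLength-injective {r} {q} {k} {k′} bk bk′ eq with Fin.<-cmp (region k) (region k′)
  ... | tri< i<j _ _ = contradiction eq (<⇒≢ (region-< {r} {q} {r} refl bk bk′ i<j))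
  ... | tri> _ _ j<i = contradiction (sym eq) (<⇒≢ (region-< {r} {q} {r} refl bk′ bk j<i))
  ... | tri≈ _ i≡j _ = suc-injective (+-cancelˡ-≡ (right j * r + left j * q) _ _
          (trans (cong (λ i → right i * r + left i * q + suc k) (sym i≡j)) eq))
    where j = region k′

  ∈-rounds : ∀ q r {x} → x ∈ roundsLengths q r →
             ∃ λ r′ → ∃ λ q′ → ∃ λ k → r ≤ r′ × suc (r′ + q′) ≡ r + q × Bounded k × x ≡ slotLength r′ q′ k
  ∈-rounds (suc q) r x∈ with ∈-++⁻ (map (slotLength r q) slots) x∈
  ... | inj₁ x∈now = let (k , k∈ , x≡) = ∈-map⁻ (slotLength r q) x∈now in
    r , q , k , ≤-refl , sym (+-suc r q) , All.lookup slots-bounded k∈ , x≡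
  ... | inj₂ x∈later = let (r′ , q′ , k , r<r′ , eq , bk , x≡) = ∈-rounds q (suc r) x∈later in
    r′ , q′ , k , <⇒≤ r<r′ , trans eq (sym (+-suc r q)) , bk , x≡

  map-unique : ∀ {f : ℕ → ℕ} {P : ℕ → Set} → (∀ {x y} → P x → P y → f x ≡ f y → x ≡ y) →
               ∀ {xs} → All P xs → Unique xs → Unique (map f xs)
  map-unique f-inj []         []         = []
  map-unique f-inj (px ∷ pxs) (x∉ ∷ xs!) =
    All.map⁺ (All.zipWith (λ (x≢y , py) fx≡fy → x≢y (f-inj px py fx≡fy)) (x∉ , pxs)) ∷ map-unique f-inj pxs xs!

  rounds-unique : ∀ q r → Unique (roundsLengths q r)
  rounds-unique zero    r = []
  rounds-unique (suc q) r = Unique.++⁺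
    (map-unique (slotLength-injective {r} {q}) slots-bounded slots-unique) (rounds-unique q (suc r)) λ (x∈now , x∈later) →
      let (k , k∈ , x≡) = ∈-map⁻ (slotLength r q) x∈now
          (r′ , q′ , k′ , r<r′ , eq , bk′ , x≡′) = ∈-rounds q (suc r) x∈later
      in slotLength-round-≢ (sym (suc-injective eq)) (All.lookup slots-bounded k∈) bk′ r<r′ (trans (sym x≡) x≡′)

  rounds-bounded : ∀ q {x} → x ∈ roundsLengths q 0 → x ≤ q * 114
  rounds-bounded q x∈ with ∈-rounds q 0 x∈
  ... | r′ , q′ , k , _ , refl , (_ , k<) , refl = begin
    right j * r′ + left j * q′ + suc k  ≤⟨ +-mono-≤ (+-mono-≤ (*-monoˡ-≤ r′ (right≤114 j)) (*-monoˡ-≤ q′ (≤-trans (left≤right j) (right≤114 j)))) (≤-trans k< (right≤114 j)) ⟩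
    114 * r′ + 114 * q′ + 114           ≡⟨ lemma r′ q′ ⟩
    suc (r′ + q′) * 114                 ∎
    where
    open ≤-Reasoning
    j = region k
    lemma : ∀ r q → 114 * r + 114 * q + 114 ≡ suc (r + q) * 114
    lemma = solve-∀

  -- One more cycle, longer than all others, makes up the number of vertices.
  paddedGraph : ∀ T d → let n = roundsWeight T 0 + T * 57 + suc d in
                Σ (Graph n (n + T * 57)) DistinctCycleLengths
  -- A ring with no digons is a plain cycle, here of length `p`.
  paddedGraph T d = extract (realise (addRing {ds = []} [] (s≤s z≤n) (rounds T 0)))
    where
    V = roundsWeight T 0
    n = V + T * 57 + suc d
    -- The bound `T * 114` on the other lengths forces at least one more; `d` absorbs the surplus
    -- vertices.
    p = suc (T * 114 + d)
    weight-eq : suc (p + 0 + V) ≡ n + suc (T * 57)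
    weight-eq = lemma V T d
      where
      lemma : ∀ V T d → suc (suc (T * 114 + d) + 0 + V) ≡ V + T * 57 + suc d + suc (T * 57)
      lemma = solve-∀
    unique : Unique (p + 0 ∷ roundsLengths T 0)
    unique = All.tabulate (λ x∈ → ≢-sym (<⇒≢ (≤-<-trans (rounds-bounded T x∈)
      (s≤s (≤-trans (m≤m+n _ d) (m≤m+n _ 0)))))) ∷ rounds-unique T 0
    extract : Realised (p + 0 ∷ roundsLengths T 0) (suc (T * 57)) (p + 0 + V) →
              Σ (Graph n (n + T * 57)) DistinctCycleLengths
    extract (k , size , G) = subst₂ (λ n m → Σ (Graph n m) DistinctCycleLengths)
      (+-cancelʳ-≡ (suc (T * 57)) k n (trans (sym size) weight-eq))
      (suc-injective (trans weight-eq (+-suc n (T * 57)))) (G unique)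

  private
    -- `z` stands for the first term of the closed formula at r = 0. The coefficient 159 is 2744 -
    -- 2699 + 2 * 57.
    weight-bound : ∀ T V n {z} → z ≡ 0 → 2 * V + 2699 * T ≡ z + 2699 * (T * T) + 2744 * T →
                   2699 * (T * T) + 159 * T + 2 ≤ 2 * n → V + T * 57 + 1 ≤ n
    weight-bound T V n refl V-closed large = *-cancelˡ-≤ 2 (≤-trans (≤-reflexive (+-cancelʳ-≡ (2699 * T) _ _ (begin
      2 * (V + T * 57 + 1) + 2699 * T                   ≡⟨ before V T ⟩
      (2 * V + 2699 * T) + (114 * T + 2)                ≡⟨ cong (_+ (114 * T + 2)) V-closed ⟩
      (2699 * (T * T) + 2744 * T) + (114 * T + 2)       ≡⟨ after T ⟩
      2699 * (T * T) + 159 * T + 2 + 2699 * T           ∎))) large)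
      where
      open ≡-Reasoning
      before : ∀ V T → 2 * (V + T * 57 + 1) + 2699 * T ≡ (2 * V + 2699 * T) + (114 * T + 2)
      before = solve-∀
      after : ∀ T → (2699 * (T * T) + 2744 * T) + (114 * T + 2) ≡ 2699 * (T * T) + 159 * T + 2 + 2699 * T
      after = solve-∀

  graph : ∀ T n → 2699 * (T * T) + 159 * T + 2 ≤ 2 * n → Σ (Graph n (n + T * 57)) DistinctCycleLengths
  graph T n large = pad (m≤n⇒∃[o]m+o≡n (weight-bound T (roundsWeight T 0) n {0 * (3676 * T)} refl (roundsWeight-closed T 0) large))
    where
    pad : (∃ λ d → roundsWeight T 0 + T * 57 + 1 + d ≡ n) → Σ (Graph n (n + T * 57)) DistinctCycleLengths
    pad (d , eq) = subst (λ n → Σ (Graph n (n + T * 57)) DistinctCycleLengths)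
      (trans (sym (+-assoc (roundsWeight T 0 + T * 57) 1 d)) eq) (paddedGraph T d)

open Design using (graph)
open import Data.Integer.Base using (+_; _-_)
open import Data.Rational.Base using (_/_; _+_)
open import Data.Integer.Base as ℤ using (+<+)
import Data.Integer.Properties as ℤ
open import Data.Nat.Base as ℕ using (zero; suc; _≤_; _<_; z≤n; s≤s; _∸_)
open import Data.Nat.Properties
open import Data.Nat.Tactic.RingSolver using (solve-∀)
open import Data.Product.Base using (Σ; ∃; _×_; _,_; proj₂)
open import Data.Rational.Base as ℚ using (ℚ; 0ℚ; nonNegative)
import Data.Rational.Properties as ℚ
open import Data.Rational.Unnormalised.Base using (mkℚᵘ; *<*) renaming (_≃_ to _≃ᵘ_)
import Data.Rational.Unnormalised.Properties as ℚᵘ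
open import Data.Sum.Base using (inj₁; inj₂)
open import Relation.Binary.PropositionalEquality
open import Relation.Nullary.Decidable.Core using (yes; no; from-yes)
open import Relation.Nullary.Negation.Core using (contradiction)

-- Rational estimates for the quotient

private
  toℚᵘ-/ : ∀ i d → ℚ.toℚᵘ (i / suc d) ≃ᵘ mkℚᵘ i d
  toℚᵘ-/ i d = ℚ.toℚᵘ-fromℚᵘ (mkℚᵘ i d)

/-< : ∀ a d b e → a ℕ.* suc e < b ℕ.* suc d → + a / suc d ℚ.< + b / suc e
/-< a d b e lt = ℚ.toℚᵘ-cancel-<
  (ℚᵘ.<-respˡ-≃ (ℚᵘ.≃-sym (toℚᵘ-/ (+ a) d)) (ℚᵘ.<-respʳ-≃ (ℚᵘ.≃-sym (toℚᵘ-/ (+ b) e))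
    (*<* (subst₂ ℤ._<_ (ℤ.pos-* a (suc e)) (ℤ.pos-* b (suc d)) (+<+ lt)))))

/-* : ∀ a d b e → (+ a / suc d) ℚ.* (+ b / suc e) ≡ + (a ℕ.* b) / (suc d ℕ.* suc e)
/-* a d b e = ℚ.toℚᵘ-injective (ℚᵘ.≃-trans (ℚ.toℚᵘ-homo-* (+ a / suc d) (+ b / suc e))
  (ℚᵘ.≃-trans (ℚᵘ.*-cong (toℚᵘ-/ (+ a) d) (toℚᵘ-/ (+ b) e))
  (ℚᵘ.≃-trans (ℚᵘ.≃-reflexive (cong (λ i → mkℚᵘ i _) (sym (ℤ.pos-* a b))))
  (ℚᵘ.≃-sym (toℚᵘ-/ (+ (a ℕ.* b)) _)))))

-- √(12/5) < 31/20 < 57 / (147/4), where 147/4 is just above √(2699/2).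
κ : ℚ
κ = + 31 / 20

√12/5<κ : ∀ {q} → ℝ.L (√ (fromℚ (+ 2 / 1 + + 2 / 5))) q → q ℚ.< κ
√12/5<κ (inj₁ q<0) = ℚ.<-trans q<0 (from-yes (0ℚ ℚ.<? κ))
√12/5<κ {q} (inj₂ q²<) with q ℚ.<? κ
... | yes q<κ = q<κ
-- κ² = 961/400 lies just above 12/5 = 960/400.
... | no  q≮κ = contradiction q²< (ℚ.<-asym (ℚ.<-≤-trans (from-yes (+ 2 / 1 + + 2 / 5 ℚ.<? κ ℚ.* κ))
    (ℚ.≤-trans (ℚ.*-monoˡ-≤-nonNeg κ κ≤q) (ℚ.*-monoʳ-≤-nonNeg q {{nonNegative 0≤q}} κ≤q))))
  where
  κ≤q = ℚ.≮⇒≥ q≮κ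
  0≤q = ℚ.≤-trans (from-yes (0ℚ ℚ.≤? κ)) κ≤q

κ<quotient : ∀ n .{{_ : NonZero n}} T K → 16 ℕ.* n < 21609 ℕ.* (T ℕ.* T) → 57 ℕ.* T ≤ K →
             ℝ.L ((+ K / 1) ÷ √ (fromℕ n) ⟨ √-positive n ⟩) κ
κ<quotient n zero K bound _ = contradiction (≤-trans bound (≤-reflexive (*-zeroʳ 21609))) λ ()
κ<quotient n@(suc _) T@(suc T′) K bound 57T≤K =
  r , s , from-yes (0ℚ ℚ.<? r) , inj₂ r²<n , (0<s , n<s²) , κr<K , κs<K
  where
  -- A positive rational below √n for every n ≥ 1.
  r = + 1 / 2
  -- The hypothesis 16 n < 147² T² says exactly that n < s². Then κ s < 57 T because 31 * 147 = 4557
  -- < 4560 = 57 * 80.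
  s = + (147 ℕ.* T) / 4
  r²<n : r ℚ.* r ℚ.< + n / 1
  r²<n = /-< 1 3 n 0 (s≤s (s≤s z≤n))
  0<s : 0ℚ ℚ.< s
  0<s = /-< 0 0 (147 ℕ.* T) 3 (s≤s z≤n)
  n<s² : + n / 1 ℚ.< s ℚ.* s
  n<s² = subst (+ n / 1 ℚ.<_) (sym (/-* (147 ℕ.* T) 3 (147 ℕ.* T) 3))
    (/-< n 0 (147 ℕ.* T ℕ.* (147 ℕ.* T)) 15 (subst₂ _<_ (*-comm 16 n) (lemma T) bound))
    where
    lemma : ∀ T → 21609 ℕ.* (T ℕ.* T) ≡ 147 ℕ.* T ℕ.* (147 ℕ.* T) ℕ.* 1
    lemma = solve-∀
  κr<K : κ ℚ.* r ℚ.< + K / 1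
  κr<K = /-< 31 39 K 0 (≤-trans (from-yes (32 ≤? 57 ℕ.* 40)) (*-monoˡ-≤ 40 (≤-trans (*-monoʳ-≤ 57 (s≤s z≤n)) 57T≤K)))
  κs<K : κ ℚ.* s ℚ.< + K / 1
  κs<K = subst (ℚ._< + K / 1) (sym (/-* 31 19 (147 ℕ.* T) 3))
    (/-< (31 ℕ.* (147 ℕ.* T)) 79 K 0 (<-≤-trans lemma (*-monoˡ-≤ 80 57T≤K)))
    where
    lhs : ∀ T → 31 ℕ.* (147 ℕ.* T) ℕ.* 1 ≡ 4557 ℕ.* T
    lhs = solve-∀
    rhs : ∀ T → 4560 ℕ.* T ≡ 57 ℕ.* T ℕ.* 80
    rhs = solve-∀
    lemma : 31 ℕ.* (147 ℕ.* T) ℕ.* 1 < 57 ℕ.* T ℕ.* 80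
    lemma = subst₂ _<_ (sym (lhs T)) (rhs T) (*-monoˡ-< T (from-yes (4557 <? 4560)))

-- The number of rounds that fit into n vertices

crossing : ∀ (h : ℕ → ℕ) {x} → h 0 ≤ x → ∀ b → x < h b → ∃ λ T → h T ≤ x × x < h (suc T)
crossing h h0≤x zero    x<h0 = contradiction h0≤x (<⇒≱ x<h0)
crossing h {x} h0≤x (suc b) x<h with x <? h b
... | yes x<hb = crossing h h0≤x b x<hb
... | no  x≮hb = b , ≮⇒≥ x≮hb , x<h

-- Twice the number of vertices needed for T rounds and the additional cycle
need : ℕ → ℕ
need T = 2699 ℕ.* (T ℕ.* T) ℕ.+ 159 ℕ.* T ℕ.+ 2

need-mono : ∀ {S T} → S ≤ T → need S ≤ need T
need-mono S≤T = +-monoˡ-≤ 2 (+-mono-≤ (*-monoʳ-≤ 2699 (*-mono-≤ S≤T S≤T)) (*-monoʳ-≤ 159 S≤T))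

<need : ∀ x → x < need x
<need x = ≤-<-trans (≤-trans (m≤n*m x 159) (m≤n+m (159 ℕ.* x) (2699 ℕ.* (x ℕ.* x)))) (m<m+n _ (s≤s z≤n))

-- The least T with 17 T² ≥ 44456 T + 22880, where 17 = 21609 - 8 * 2699 is the gain from rounding
-- √(2699/2) up to 147/4.
T₀ : ℕ
T₀ = 2616

-- 21609 = 147²
need-bound : ∀ T → T₀ ≤ T → 8 ℕ.* need (suc T) ≤ 21609 ℕ.* (T ℕ.* T)
need-bound T T₀≤T = begin
  8 ℕ.* need (suc T)                                       ≡⟨ before T ⟩
  21592 ℕ.* (T ℕ.* T) ℕ.+ 44456 ℕ.* T ℕ.+ 22880            ≤⟨ +-monoʳ-≤ (21592 ℕ.* (T ℕ.* T) ℕ.+ 44456 ℕ.* T) (≤-trans (from-yes (22880 ≤? 16 ℕ.* T₀)) (*-monoʳ-≤ 16 T₀≤T)) ⟩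
  21592 ℕ.* (T ℕ.* T) ℕ.+ 44456 ℕ.* T ℕ.+ 16 ℕ.* T         ≡⟨ middle T ⟩
  21592 ℕ.* (T ℕ.* T) ℕ.+ 17 ℕ.* 2616 ℕ.* T                ≡⟨ cong (21592 ℕ.* (T ℕ.* T) ℕ.+_) (*-assoc 17 2616 T) ⟩
  21592 ℕ.* (T ℕ.* T) ℕ.+ 17 ℕ.* (2616 ℕ.* T)              ≤⟨ +-monoʳ-≤ (21592 ℕ.* (T ℕ.* T)) (*-monoʳ-≤ 17 (*-monoˡ-≤ T T₀≤T)) ⟩
  21592 ℕ.* (T ℕ.* T) ℕ.+ 17 ℕ.* (T ℕ.* T)                 ≡⟨ *-distribʳ-+ (T ℕ.* T) 21592 17 ⟨
  21609 ℕ.* (T ℕ.* T)                                      ∎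
  where
  open ≤-Reasoning
  before : ∀ T → 8 ℕ.* (2699 ℕ.* (suc T ℕ.* suc T) ℕ.+ 159 ℕ.* suc T ℕ.+ 2) ≡ 21592 ℕ.* (T ℕ.* T) ℕ.+ 44456 ℕ.* T ℕ.+ 22880
  before = solve-∀
  middle : ∀ T → 21592 ℕ.* (T ℕ.* T) ℕ.+ 44456 ℕ.* T ℕ.+ 16 ℕ.* T ≡ 21592 ℕ.* (T ℕ.* T) ℕ.+ 44472 ℕ.* T
  middle = solve-∀

-- T is chosen so that T rounds fit into n vertices but T + 1 do not; the failure for T + 1 bounds n
-- from above in terms of T.
manyEdges : ∀ n → need T₀ ≤ n → ∃ λ T → 16 ℕ.* n < 21609 ℕ.* (T ℕ.* T) × Σ (Graph n (n ℕ.+ T ℕ.* 57)) DistinctCycleLengths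
manyEdges n N≤n = conclude (crossing need {2 ℕ.* n} (≤-trans (need-mono {0} {T₀} z≤n) N≤2n) (2 ℕ.* n) (<need (2 ℕ.* n)))
  where
  N≤2n : need T₀ ≤ 2 ℕ.* n
  N≤2n = ≤-trans N≤n (m≤n*m n 2)
  conclude : (∃ λ T → need T ≤ 2 ℕ.* n × 2 ℕ.* n < need (suc T)) →
             ∃ λ T → 16 ℕ.* n < 21609 ℕ.* (T ℕ.* T) × Σ (Graph n (n ℕ.+ T ℕ.* 57)) DistinctCycleLengths
  conclude (T , enough , tooFew) = T , <-≤-trans
    (subst (_< 8 ℕ.* need (suc T)) (sym (*-assoc 8 2 n)) (*-monoʳ-< 8 tooFew))
    -- If T < T₀, then T + 1 rounds would still fit, since n has room for T₀.
    (need-bound T (≮⇒≥ λ T<T₀ → <⇒≱ tooFew (≤-trans (need-mono T<T₀) N≤2n))) ,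
    graph T n enough

mainTheorem2 : (f : ℕ → ℕ) →
    (∀ n → .{{_ : NonZero n}} → IsMaxEdges n (f n)) →
    lower (√ (fromℚ (+ 2 / 1 + + 2 / 5))) ≤ᴸ
    liminf (λ n → ((+ f n - + n) / 1) ÷ √ (fromℕ n) ⟨ √-positive n ⟩)
-- The infimum asks for one rational above q that lies below all later quotients; κ serves for every
-- q below √(12/5).
mainTheorem2 f isMax q<√12/5 = need T₀ , κ , √12/5<κ q<√12/5 , λ (n , n≢0 , N≤n) →
  large n {{n≢0}} (manyEdges n N≤n)
  where
  large : ∀ n .{{_ : NonZero n}} → (∃ λ T → 16 ℕ.* n < 21609 ℕ.* (T ℕ.* T) × Σ (Graph n (n ℕ.+ T ℕ.* 57)) DistinctCycleLengths) →
          ℝ.L (((+ f n - + n) / 1) ÷ √ (fromℕ n) ⟨ √-positive n ⟩) κ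
  large n (T , bound , G) = subst (λ i → ℝ.L ((i / 1) ÷ √ (fromℕ n) ⟨ √-positive n ⟩) κ)
    (sym (trans (ℤ.m-n≡m⊖n (f n) n) (ℤ.⊖-≥ (m+n≤o⇒m≤o n many))))
    (κ<quotient n T (f n ∸ n) bound (subst (_≤ f n ∸ n) (*-comm T 57)
      (m+n≤o⇒m≤o∸n (T ℕ.* 57) (subst (_≤ f n) (+-comm n (T ℕ.* 57)) many))))
    where
    many : n ℕ.+ T ℕ.* 57 ≤ f n
    many = proj₂ (isMax n) G
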